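{- Let $\alpha$ be a real number and $p/q\in\mathbb{Q}(\mathbf{H}_4)$ (in normalized form). (i) If $p/q$ is an $\mathbf{H}_4$-best approximation of $\alpha$, then $$\left|\alpha-\frac pq\right|<\frac1{q^2}.$$ (ii) If $$\left|\alpha-\frac pq\right|<\frac1{2q^2},$$ then $p/q$ is an $\mathbf{H}_4$-best approximation of $\alpha$. Moreover, the constant $1/2$ is optimal: it cannot be replaced by any larger number, i.e. for every $c>1/2$ there exist a real number $\alpha$ and $p/q\in\mathbb{Q}(\mathbf{H}_4)$ with $\left|\alpha-\frac pq\right|<\frac{c}{q^2}$ such that $p/q$ is not an $\mathbf{H}_4$-best approximation of $\alpha$.
   Context: The Hecke group $\mathbf{H}_4$ is the subgroup of $\mathrm{PSL}_2(\mathbb{R})$ generated by $\begin{pmatrix}1&\sqrt2\\0&1\end{pmatrix}$ and $\begin{pmatrix}0&-1\\1&0\end{pmatrix}$. The set $\mathbb{Q}(\mathbf{H}_4)\subset \mathbb{R}\cup\{\infty\}$ is the set of all $p/q$ such that $\begin{pmatrix} p & r \\ q & s \end{pmatrix}\in\mathbf{H}_4$ for some $r,s$; its finite elements form the set $\sqrt2\,\mathbb{Q}$. Writing $p/q\in\mathbb{Q}(\mathbf{H}_4)$ always means the normalized form: $(p,q)$ is the first column of a matrix in $\mathbf{H}_4$ with $q>0$. Explicitly, either $p=a$, $q=\sqrt2\,c$ with $a,c\in\mathbb{Z}$, $c>0$, $\gcd(a,2c)=1$, or $p=\sqrt2\,a$, $q=c$ with $a,c\in\mathbb{Z}$, $c>0$,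 $\gcd(2a,c)=1$. $p/q\in\mathbb{Q}(\mathbf{H}_4)$ is an $\mathbf{H}_4$-best approximation of a real number $\alpha$ if for any $r/s\in\mathbb{Q}(\mathbf{H}_4)$ with $r/s\ne p/q$ and $0<s\le q$ one has $|s\alpha-r|>|q\alpha-p|$. -}

module Defs where

open import Data.Bool.Base using (if_then_else_)
open import Data.Integer.Base as ℤ using (ℤ)
import Data.Integer.Properties as ℤₚ
open import Data.Nat.Base as ℕ using (ℕ; zero; suc)
import Data.Nat.Properties as ℕₚ
open import Data.Product.Base using (∃-syntax; _×_; _,_; proj₁; proj₂)
open import Data.Rational.Base as ℚ using (ℚ; 0ℚ; 1ℚ; ½; mkℚ)
import Data.Rational.Properties as ℚₚ
import Data.Rational.Unnormalised.Base as ℚᵘ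
import Data.Rational.Unnormalised.Properties as ℚᵘₚ
open import Data.Rational.Solver using (module +-*-Solver)
open import Data.Sum.Base using (_⊎_; inj₁; inj₂)
open import Relation.Binary.PropositionalEquality
  using (_≡_; refl; sym; trans; cong; cong₂; subst; subst₂)
open import Relation.Nullary using (¬_; Dec; yes; no; does)

-- Reals are Cauchy sequences of rationals up to _≈_; ∃ supplies the modulus
-- of convergence as data, so no choice principle is needed.
IsCauchy : (ℕ → ℚ) → Set
IsCauchy x = ∀ ε → 0ℚ ℚ.< ε →
  ∃[ N ] ∀ m n → N ℕ.≤ m → N ℕ.≤ n → ℚ.∣ x m ℚ.- x n ∣ ℚ.< ε

record ℝ : Set where
  constructor mkℝ
  field
    seq    : ℕ → ℚ
    cauchy : IsCauchy seq

open ℝ public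

infix 4 _≈_ _<_ _≤_

_≈_ : ℝ → ℝ → Set
x ≈ y = ∀ ε → 0ℚ ℚ.< ε →
  ∃[ N ] ∀ n → N ℕ.≤ n → ℚ.∣ seq x n ℚ.- seq y n ∣ ℚ.< ε

-- A termwise comparison would depend on the representatives; the gap ε
-- makes _<_ respect _≈_.
_<_ : ℝ → ℝ → Set
x < y = ∃[ ε ] 0ℚ ℚ.< ε × ∃[ N ] ∀ n → N ℕ.≤ n → seq x n ℚ.+ ε ℚ.≤ seq y n

_≤_ : ℝ → ℝ → Set
x ≤ y = ¬ (y < x)

private
  open +-*-Solver using (solve; _:=_; _:+_; _:*_; _:-_; :-_; con)

  abstract
    abs≤ : ∀ {a b} → a ℚ.≤ b → ℚ.- a ℚ.≤ b → ℚ.∣ a ∣ ℚ.≤ b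
    abs≤ {a} p q with ℚₚ.∣p∣≡p∨∣p∣≡-p a
    ... | inj₁ e = subst (ℚ._≤ _) (sym e) p
    ... | inj₂ e = subst (ℚ._≤ _) (sym e) q

    abs< : ∀ {a b} → a ℚ.< b → ℚ.- a ℚ.< b → ℚ.∣ a ∣ ℚ.< b
    abs< {a} p q with ℚₚ.∣p∣≡p∨∣p∣≡-p a
    ... | inj₁ e = subst (ℚ._< _) (sym e) p
    ... | inj₂ e = subst (ℚ._< _) (sym e) q

    abs-swap : ∀ a b → ℚ.∣ a ℚ.- b ∣ ≡ ℚ.∣ b ℚ.- a ∣
    abs-swap a b = trans (cong ℚ.∣_∣ (solve 2 (λ a b → a :- b := :- (b :- a)) refl a b))
                         (ℚₚ.∣-p∣≡∣p∣ (b ℚ.- a))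

    abs-diff₁ : ∀ a b → ℚ.∣ a ∣ ℚ.- ℚ.∣ b ∣ ℚ.≤ ℚ.∣ a ℚ.- b ∣
    abs-diff₁ a b = subst (ℚ.∣ a ∣ ℚ.- ℚ.∣ b ∣ ℚ.≤_)
      (solve 2 (λ x y → (x :+ y) :- y := x) refl ℚ.∣ a ℚ.- b ∣ ℚ.∣ b ∣)
      (ℚₚ.+-monoˡ-≤ (ℚ.- ℚ.∣ b ∣)
        (subst (λ z → ℚ.∣ z ∣ ℚ.≤ ℚ.∣ a ℚ.- b ∣ ℚ.+ ℚ.∣ b ∣)
          (solve 2 (λ a b → (a :- b) :+ b := a) refl a b)
          (ℚₚ.∣p+q∣≤∣p∣+∣q∣ (a ℚ.- b) b)))

    abs-diff : ∀ a b → ℚ.∣ ℚ.∣ a ∣ ℚ.- ℚ.∣ b ∣ ∣ ℚ.≤ ℚ.∣ a ℚ.- b ∣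
    abs-diff a b = abs≤ (abs-diff₁ a b)
      (subst₂ ℚ._≤_
        (solve 2 (λ x y → y :- x := :- (x :- y)) refl ℚ.∣ a ∣ ℚ.∣ b ∣)
        (abs-swap b a) (abs-diff₁ b a))

    half-pos : ∀ {ε} → 0ℚ ℚ.< ε → 0ℚ ℚ.< ½ ℚ.* ε
    half-pos {ε} p = subst (ℚ._< ½ ℚ.* ε) (ℚₚ.*-zeroʳ ½) (ℚₚ.*-monoʳ-<-pos ½ p)

    halves : ∀ ε → ½ ℚ.* ε ℚ.+ ½ ℚ.* ε ≡ ε
    halves = solve 1 (λ e → con ½ :* e :+ con ½ :* e := e) refl

    mul-pos : ∀ {a b} → 0ℚ ℚ.< a → 0ℚ ℚ.< b → 0ℚ ℚ.< a ℚ.* b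
    mul-pos {a} {b} p q = subst (ℚ._< a ℚ.* b) (ℚₚ.*-zeroʳ a)
      (ℚₚ.*-monoʳ-<-pos a {{ℚ.positive p}} q)

    mul-mono-≤ : ∀ {a b c d} → 0ℚ ℚ.≤ a → 0ℚ ℚ.≤ d → a ℚ.≤ b → c ℚ.≤ d →
                 a ℚ.* c ℚ.≤ b ℚ.* d
    mul-mono-≤ {a} {b} {c} {d} a≥0 d≥0 p q = ℚₚ.≤-trans
      (ℚₚ.*-monoˡ-≤-nonNeg a {{ℚ.nonNegative a≥0}} q)
      (ℚₚ.*-monoʳ-≤-nonNeg d {{ℚ.nonNegative d≥0}} p)

    +-cauchy : ∀ {x y} → IsCauchy x → IsCauchy y → IsCauchy (λ n → x n ℚ.+ y n)
    +-cauchy {x} {y} cx cy ε ε>0 with cx _ (half-pos ε>0) | cy _ (half-pos ε>0)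
    ... | M , f | N , g = M ℕ.⊔ N , λ m n p q →
      ℚₚ.≤-<-trans
        (subst (λ z → ℚ.∣ z ∣ ℚ.≤ ℚ.∣ x m ℚ.- x n ∣ ℚ.+ ℚ.∣ y m ℚ.- y n ∣)
          (solve 4 (λ a b c d → (a :- b) :+ (c :- d) := (a :+ c) :- (b :+ d)) refl
            (x m) (x n) (y m) (y n))
          (ℚₚ.∣p+q∣≤∣p∣+∣q∣ (x m ℚ.- x n) (y m ℚ.- y n)))
        (subst (_ ℚ.<_) (halves ε)
          (ℚₚ.+-mono-<
            (f m n (ℕₚ.m⊔n≤o⇒m≤o M N p) (ℕₚ.m⊔n≤o⇒m≤o M N q))
            (g m n (ℕₚ.m⊔n≤o⇒n≤o M N p) (ℕₚ.m⊔n≤o⇒n≤o M N q))))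

    -‿cauchy : ∀ {x} → IsCauchy x → IsCauchy (λ n → ℚ.- x n)
    -‿cauchy {x} cx ε ε>0 with cx ε ε>0
    ... | N , f = N , λ m n p q → subst (ℚ._< ε)
      (trans (abs-swap (x m) (x n)) (cong ℚ.∣_∣
        (solve 2 (λ a b → b :- a := (:- a) :- (:- b)) refl (x m) (x n))))
      (f m n p q)

    abs-cauchy : ∀ {x} → IsCauchy x → IsCauchy (λ n → ℚ.∣ x n ∣)
    abs-cauchy {x} cx ε ε>0 with cx ε ε>0
    ... | N , f = N , λ m n p q → ℚₚ.≤-<-trans (abs-diff (x m) (x n)) (f m n p q)

    bounded : ∀ {x} → IsCauchy x →
      ∃[ B ] 0ℚ ℚ.< B × ∃[ N ] ∀ n → N ℕ.≤ n → ℚ.∣ x n ∣ ℚ.≤ B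
    bounded {x} cx with cx 1ℚ (ℚₚ.positive⁻¹ 1ℚ)
    ... | N , f = B , B>0 , N , λ n p → ℚₚ.≤-trans
        (subst (λ z → ℚ.∣ z ∣ ℚ.≤ ℚ.∣ x n ℚ.- x N ∣ ℚ.+ ℚ.∣ x N ∣)
          (solve 2 (λ a b → (a :- b) :+ b := a) refl (x n) (x N))
          (ℚₚ.∣p+q∣≤∣p∣+∣q∣ (x n ℚ.- x N) (x N)))
        (ℚₚ.+-monoˡ-≤ ℚ.∣ x N ∣ (ℚₚ.<⇒≤ (f n N p ℕₚ.≤-refl)))
      where
      B : ℚ
      B = 1ℚ ℚ.+ ℚ.∣ x N ∣
      B>0 : 0ℚ ℚ.< B
      B>0 = ℚₚ.+-mono-<-≤ (ℚₚ.positive⁻¹ 1ℚ) (ℚₚ.0≤∣p∣ (x N))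

    term< : ∀ {a b D δ} → 0ℚ ℚ.< D → ℚ.∣ a ∣ ℚ.≤ D → ℚ.∣ b ∣ ℚ.< δ → ℚ.∣ a ℚ.* b ∣ ℚ.< D ℚ.* δ
    term< {a} {b} {D} {δ} D>0 p q = subst (ℚ._< D ℚ.* δ) (sym (ℚₚ.∣p*q∣≡∣p∣*∣q∣ a b))
      (ℚₚ.≤-<-trans
        (ℚₚ.*-monoʳ-≤-nonNeg ℚ.∣ b ∣ {{ℚₚ.∣-∣-nonNeg b}} p)
        (ℚₚ.*-monoʳ-<-pos D {{ℚ.positive D>0}} q))

    prod-split : ∀ a b c d → a ℚ.* (c ℚ.- d) ℚ.+ d ℚ.* (a ℚ.- b) ≡ a ℚ.* c ℚ.- b ℚ.* d
    prod-split = solve 4 (λ a b c d → (a :* (c :- d)) :+ (d :* (a :- b)) := (a :* c) :- (b :* d)) refl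

    prod-close : ∀ {a b c d A B δ} → 0ℚ ℚ.< A → 0ℚ ℚ.< B → ℚ.∣ a ∣ ℚ.≤ A → ℚ.∣ d ∣ ℚ.≤ B →
      ℚ.∣ a ℚ.- b ∣ ℚ.< δ → ℚ.∣ c ℚ.- d ∣ ℚ.< δ →
      ℚ.∣ a ℚ.* c ℚ.- b ℚ.* d ∣ ℚ.< A ℚ.* δ ℚ.+ B ℚ.* δ
    prod-close {a} {b} {c} {d} A>0 B>0 a≤ d≤ ab cd = ℚₚ.≤-<-trans
      (subst (λ z → ℚ.∣ z ∣ ℚ.≤ ℚ.∣ a ℚ.* (c ℚ.- d) ∣ ℚ.+ ℚ.∣ d ℚ.* (a ℚ.- b) ∣)
        (prod-split a b c d)
        (ℚₚ.∣p+q∣≤∣p∣+∣q∣ (a ℚ.* (c ℚ.- d)) (d ℚ.* (a ℚ.- b))))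
      (ℚₚ.+-mono-< (term< A>0 a≤ cd) (term< B>0 d≤ ab))

    regroup : ∀ a b e i → a ℚ.* (e ℚ.* i) ℚ.+ b ℚ.* (e ℚ.* i) ≡ e ℚ.* ((a ℚ.+ b) ℚ.* i)
    regroup = solve 4 (λ a b e i → a :* (e :* i) :+ b :* (e :* i) := e :* ((a :+ b) :* i)) refl

    share : ∀ A B ε → 0ℚ ℚ.< A → 0ℚ ℚ.< B → 0ℚ ℚ.< ε →
            ∃[ δ ] 0ℚ ℚ.< δ × A ℚ.* δ ℚ.+ B ℚ.* δ ≡ ε
    share A B ε A>0 B>0 ε>0 = ε ℚ.* i , mul-pos ε>0 (ℚₚ.positive⁻¹ i {{ℚₚ.1/pos⇒pos C}})
      , trans (regroup A B ε i)
          (trans (cong (ε ℚ.*_) (ℚₚ.*-inverseʳ C)) (ℚₚ.*-identityʳ ε))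
      where
      C : ℚ
      C = A ℚ.+ B
      instance
        C-pos : ℚ.Positive C
        C-pos = ℚ.positive (ℚₚ.+-mono-< A>0 B>0)
        C-nz : ℚ.NonZero C
        C-nz = ℚₚ.pos⇒nonZero C
      i : ℚ
      i = ℚ.1/ C

    *-cauchy : ∀ {x y} → IsCauchy x → IsCauchy y → IsCauchy (λ n → x n ℚ.* y n)
    *-cauchy {x} {y} cx cy ε ε>0 =
      let A , A>0 , K , bx = bounded {x} cx
          B , B>0 , L , by = bounded {y} cy
          δ , δ>0 , sum    = share A B ε A>0 B>0 ε>0
          M , f            = cx δ δ>0
          N , g            = cy δ δ>0
      in (K ℕ.⊔ L) ℕ.⊔ (M ℕ.⊔ N) , λ m n p q →
        let pKL = ℕₚ.m⊔n≤o⇒m≤o (K ℕ.⊔ L) (M ℕ.⊔ N) p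
            pMN = ℕₚ.m⊔n≤o⇒n≤o (K ℕ.⊔ L) (M ℕ.⊔ N) p
            qKL = ℕₚ.m⊔n≤o⇒m≤o (K ℕ.⊔ L) (M ℕ.⊔ N) q
            qMN = ℕₚ.m⊔n≤o⇒n≤o (K ℕ.⊔ L) (M ℕ.⊔ N) q
        in ℚₚ.<-≤-trans
             (prod-close {x m} {x n} {y m} {y n} {A} {B} {δ} A>0 B>0
               (bx m (ℕₚ.m⊔n≤o⇒m≤o K L pKL))
               (by n (ℕₚ.m⊔n≤o⇒n≤o K L qKL))
               (f m n (ℕₚ.m⊔n≤o⇒m≤o M N pMN) (ℕₚ.m⊔n≤o⇒m≤o M N qMN))
               (g m n (ℕₚ.m⊔n≤o⇒n≤o M N pMN) (ℕₚ.m⊔n≤o⇒n≤o M N qMN)))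
             (ℚₚ.≤-reflexive sum)

infixl 6 _+_ _-_
infixl 7 _*_ _/_⟨_⟩
infix  8 -_

fromℚ : ℚ → ℝ
fromℚ a = mkℝ (λ _ → a) (λ ε ε>0 → 0 , λ _ _ _ _ →
  subst (ℚ._< ε) (sym (cong ℚ.∣_∣ (ℚₚ.+-inverseʳ a))) ε>0)

0ℝ 1ℝ : ℝ
0ℝ = fromℚ 0ℚ
1ℝ = fromℚ 1ℚ

_+_ : ℝ → ℝ → ℝ
x + y = mkℝ (λ n → seq x n ℚ.+ seq y n) (+-cauchy {seq x} {seq y} (cauchy x) (cauchy y))

-_ : ℝ → ℝ
- x = mkℝ (λ n → ℚ.- seq x n) (-‿cauchy {seq x} (cauchy x))

_-_ : ℝ → ℝ → ℝ
x - y = x + (- y)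

_*_ : ℝ → ℝ → ℝ
x * y = mkℝ (λ n → seq x n ℚ.* seq y n) (*-cauchy {seq x} {seq y} (cauchy x) (cauchy y))

∣_∣ : ℝ → ℝ
∣ x ∣ = mkℝ (λ n → ℚ.∣ seq x n ∣) (abs-cauchy {seq x} (cauchy x))

recipAbove : (ε : ℚ) → 0ℚ ℚ.< ε → ℚ → ℚ
recipAbove ε ε>0 a = ℚ.1/_ (ε ℚ.⊔ a)
  {{ℚ.>-nonZero (ℚₚ.<-≤-trans ε>0 (ℚₚ.p≤p⊔q ε a))}}

private
  abstract
    recip-inv : ∀ ε ε>0 a → ε ℚ.≤ a → a ℚ.* recipAbove ε ε>0 a ≡ 1ℚ
    recip-inv ε ε>0 a ε≤a =
      trans (cong (ℚ._* recipAbove ε ε>0 a) (sym (ℚₚ.p≤q⇒p⊔q≡q ε≤a)))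
        (ℚₚ.*-inverseʳ (ε ℚ.⊔ a) {{ℚ.>-nonZero (ℚₚ.<-≤-trans ε>0 (ℚₚ.p≤p⊔q ε a))}})

    inv-cauchy : ∀ ε (ε>0 : 0ℚ ℚ.< ε) {x} N → (∀ n → N ℕ.≤ n → 0ℚ ℚ.+ ε ℚ.≤ x n) →
                 IsCauchy x → IsCauchy (λ n → recipAbove ε ε>0 (x n))
    inv-cauchy ε ε>0 {x} N lb cx η η>0 with cx (ε ℚ.* ε ℚ.* η) (mul-pos (mul-pos ε>0 ε>0) η>0)
    ... | M , f = N ℕ.⊔ M , λ m n p q →
      let a  = x m
          b  = x n
          i  = recipAbove ε ε>0 a
          j  = recipAbove ε ε>0 b
          ε≤a = subst (ℚ._≤ a) (ℚₚ.+-identityˡ ε) (lb m (ℕₚ.m⊔n≤o⇒m≤o N M p))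
          ε≤b = subst (ℚ._≤ b) (ℚₚ.+-identityˡ ε) (lb n (ℕₚ.m⊔n≤o⇒m≤o N M q))
          a≥0 = ℚₚ.≤-trans (ℚₚ.<⇒≤ ε>0) ε≤a
          b≥0 = ℚₚ.≤-trans (ℚₚ.<⇒≤ ε>0) ε≤b
          eq : a ℚ.* b ℚ.* (i ℚ.- j) ≡ b ℚ.- a
          eq = trans
            (solve 4 (λ a b i j → a :* b :* (i :- j) := b :* (a :* i) :- a :* (b :* j)) refl a b i j)
            (trans (cong₂ (λ s t → b ℚ.* s ℚ.- a ℚ.* t)
                     (recip-inv ε ε>0 a ε≤a) (recip-inv ε ε>0 b ε≤b))
              (solve 2 (λ a b → b :* con 1ℚ :- a :* con 1ℚ := b :- a) refl a b))
          ab≥0 = mul-mono-≤ {0ℚ} {a} {0ℚ} {b} ℚₚ.≤-refl b≥0 a≥0 b≥0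
          ∣ab∣ : ℚ.∣ a ℚ.* b ∣ ≡ a ℚ.* b
          ∣ab∣ = ℚₚ.0≤p⇒∣p∣≡p ab≥0
          eq′ : a ℚ.* b ℚ.* ℚ.∣ i ℚ.- j ∣ ≡ ℚ.∣ a ℚ.- b ∣
          eq′ = trans (cong (ℚ._* ℚ.∣ i ℚ.- j ∣) (sym ∣ab∣))
            (trans (sym (ℚₚ.∣p*q∣≡∣p∣*∣q∣ (a ℚ.* b) (i ℚ.- j)))
              (trans (cong ℚ.∣_∣ eq) (abs-swap b a)))
      in ℚₚ.*-cancelˡ-<-nonNeg (ε ℚ.* ε)
           {{ℚ.nonNegative (ℚₚ.<⇒≤ (mul-pos ε>0 ε>0))}}
           (ℚₚ.≤-<-trans
             (ℚₚ.*-monoʳ-≤-nonNeg ℚ.∣ i ℚ.- j ∣ {{ℚₚ.∣-∣-nonNeg (i ℚ.- j)}}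
               (mul-mono-≤ (ℚₚ.<⇒≤ ε>0) b≥0 ε≤a ε≤b))
             (subst (ℚ._< ε ℚ.* ε ℚ.* η) (sym eq′)
               (f m n (ℕₚ.m⊔n≤o⇒n≤o N M p) (ℕₚ.m⊔n≤o⇒n≤o N M q))))

-- The terms of y eventually exceed the gap ε supplied by 0 < y, and from
-- there on recipAbove is the ordinary rational reciprocal.
inverse : (y : ℝ) → 0ℝ < y → ℝ
inverse y (ε , ε>0 , N , lb) =
  mkℝ (λ n → recipAbove ε ε>0 (seq y n)) (inv-cauchy ε ε>0 {seq y} N lb (cauchy y))

_/_⟨_⟩ : ℝ → (y : ℝ) → 0ℝ < y → ℝ
x / y ⟨ y>0 ⟩ = x * inverse y y>0

abstract
  *-inverse : ∀ y (y>0 : 0ℝ < y) → y * inverse y y>0 ≈ 1ℝ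
  *-inverse y (ε , ε>0 , N , lb) η η>0 = N , λ n p →
    subst (λ z → ℚ.∣ z ℚ.- 1ℚ ∣ ℚ.< η)
      (sym (recip-inv ε ε>0 (seq y n) (subst (ℚ._≤ seq y n) (ℚₚ.+-identityˡ ε) (lb n p))))
      η>0

  *-pos : ∀ {x y} → 0ℝ < x → 0ℝ < y → 0ℝ < x * y
  *-pos {x} {y} (ε , ε>0 , M , f) (η , η>0 , N , g) =
    ε ℚ.* η , mul-pos ε>0 η>0 , M ℕ.⊔ N , λ n p →
      let ε≤x = subst (ℚ._≤ seq x n) (ℚₚ.+-identityˡ ε) (f n (ℕₚ.m⊔n≤o⇒m≤o M N p))
          η≤y = subst (ℚ._≤ seq y n) (ℚₚ.+-identityˡ η) (g n (ℕₚ.m⊔n≤o⇒n≤o M N p))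
      in subst (ℚ._≤ seq x n ℚ.* seq y n) (sym (ℚₚ.+-identityˡ (ε ℚ.* η)))
           (mul-mono-≤ (ℚₚ.<⇒≤ ε>0) (ℚₚ.≤-trans (ℚₚ.<⇒≤ η>0) η≤y) ε≤x η≤y)

2ℚ : ℚ
2ℚ = 1ℚ ℚ.+ 1ℚ

½^ : ℕ → ℚ
½^ zero    = 1ℚ
½^ (suc n) = ½ ℚ.* ½^ n

-- The n-th term is the largest multiple of 2⁻ⁿ whose square is at most 2,
-- found greedily one binary digit at a time.
√2-digits : ℕ → ℚ
√2-digits zero    = 1ℚ
√2-digits (suc n) =
  let t = √2-digits n ℚ.+ ½^ (suc n)
  in if does (t ℚ.* t ℚₚ.≤? 2ℚ) then t else √2-digits n

private
  abstract
    ½^-pos : ∀ n → 0ℚ ℚ.< ½^ n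
    ½^-pos zero    = ℚₚ.positive⁻¹ 1ℚ
    ½^-pos (suc n) = half-pos (½^-pos n)

    ½^-step : ∀ n → ½^ (suc n) ℚ.< ½^ n
    ½^-step n = subst₂ ℚ._<_ (ℚₚ.+-identityʳ _) (halves (½^ n))
      (ℚₚ.+-monoʳ-< (½^ (suc n)) (½^-pos (suc n)))

    ½^-anti : ∀ {m n} → m ℕ.≤′ n → ½^ n ℚ.≤ ½^ m
    ½^-anti (ℕ.≤′-reflexive refl) = ℚₚ.≤-refl
    ½^-anti (ℕ.≤′-step {n} p)     = ℚₚ.≤-trans (ℚₚ.<⇒≤ (½^-step n)) (½^-anti p)

    fromNat : ℕ → ℚ
    fromNat zero    = 0ℚ
    fromNat (suc n) = 1ℚ ℚ.+ fromNat n

    fromNat-nonNeg : ∀ n → 0ℚ ℚ.≤ fromNat n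
    fromNat-nonNeg zero    = ℚₚ.≤-refl
    fromNat-nonNeg (suc n) = ℚₚ.+-mono-≤ (ℚₚ.<⇒≤ (ℚₚ.positive⁻¹ 1ℚ)) (fromNat-nonNeg n)

    fromNat-toℚᵘ : ∀ n → ℚ.toℚᵘ (fromNat n) ℚᵘ.≃ ℚᵘ.mkℚᵘ (ℤ.+ n) 0
    fromNat-toℚᵘ zero    = ℚᵘₚ.≃-refl
    fromNat-toℚᵘ (suc n) = ℚᵘₚ.≃-trans (ℚₚ.toℚᵘ-homo-+ 1ℚ (fromNat n))
      (ℚᵘₚ.≃-trans (ℚᵘₚ.+-congʳ ℚᵘ.1ℚᵘ (fromNat-toℚᵘ n))
        (ℚᵘ.*≡* (cong (λ z → (ℤ.+ 1 ℤ.+ z) ℤ.* ℤ.+ 1) (ℤₚ.*-identityʳ (ℤ.+ n)))))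

    ½^-bound : ∀ n → fromNat (suc n) ℚ.* ½^ n ℚ.≤ 1ℚ
    ½^-bound zero    = ℚₚ.≤-refl
    ½^-bound (suc n) = ℚₚ.≤-trans
      (subst (fromNat (2 ℕ.+ n) ℚ.* ½^ (suc n) ℚ.≤_)
        (solve 2 (λ k h → (con 1ℚ :+ (con 1ℚ :+ k)) :* (con ½ :* h) :+ k :* (con ½ :* h)
                            := (con 1ℚ :+ k) :* h) refl (fromNat n) (½^ n))
        (subst (ℚ._≤ fromNat (2 ℕ.+ n) ℚ.* ½^ (suc n) ℚ.+ fromNat n ℚ.* ½^ (suc n))
          (ℚₚ.+-identityʳ _)
          (ℚₚ.+-monoʳ-≤ (fromNat (2 ℕ.+ n) ℚ.* ½^ (suc n))
            (mul-mono-≤ {0ℚ} {fromNat n} {0ℚ} {½^ (suc n)} ℚₚ.≤-refl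
              (ℚₚ.<⇒≤ (½^-pos (suc n))) (fromNat-nonNeg n) (ℚₚ.<⇒≤ (½^-pos (suc n)))))))
      (½^-bound n)

    archimedean : ∀ ε → 0ℚ ℚ.< ε → ∃[ d ] 1ℚ ℚ.≤ fromNat (suc d) ℚ.* ε
    archimedean ε@(mkℚ (ℤ.+ zero) d c) ε>0 with ℚ.positive ε>0
    ... | ()
    archimedean ε@(mkℚ ℤ.-[1+ k ] d c) ε>0 with ℚ.positive ε>0
    ... | ()
    archimedean ε@(mkℚ (ℤ.+ suc k) d c) ε>0 = d , ℚₚ.toℚᵘ-cancel-≤
      (ℚᵘₚ.≤-respʳ-≃ (ℚᵘₚ.≃-sym (ℚᵘₚ.≃-trans (ℚₚ.toℚᵘ-homo-* (fromNat (suc d)) ε)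
                        (ℚᵘₚ.*-congʳ (fromNat-toℚᵘ (suc d)))))
        (ℚᵘ.*≤* (ℤ.+≤+ (subst₂ ℕ._≤_
          (sym (trans (ℕₚ.+-identityʳ _) (ℕₚ.+-identityʳ _)))
          (sym (ℕₚ.*-identityʳ _))
          (ℕₚ.m≤m*n (suc d) (suc k))))))

    ½^-small : ∀ ε → 0ℚ ℚ.< ε → ∃[ N ] ∀ n → N ℕ.≤ n → ½^ n ℚ.< ε
    ½^-small ε ε>0 with archimedean ε ε>0
    ... | d , 1≤ = suc d , λ n p → ℚₚ.≤-<-trans (½^-anti (ℕₚ.≤⇒≤′ p))
      (ℚₚ.<-≤-trans (½^-step d)
        (ℚₚ.*-cancelˡ-≤-pos (fromNat (suc d))
          {{ℚ.positive (ℚₚ.+-mono-<-≤ (ℚₚ.positive⁻¹ 1ℚ) (fromNat-nonNeg d))}}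
          (ℚₚ.≤-trans (½^-bound d) 1≤)))

    if-does : ∀ {A P : Set} (d : Dec P) (Q : A → Set) {t f} →
              (P → Q t) → (¬ P → Q f) → Q (if does d then t else f)
    if-does (yes p) Q qt qf = qt p
    if-does (no ¬p) Q qt qf = qf ¬p

    Digits : ℚ → ℚ → Set
    Digits h a = 1ℚ ℚ.≤ a × a ℚ.* a ℚ.≤ 2ℚ × 2ℚ ℚ.< (a ℚ.+ h) ℚ.* (a ℚ.+ h)

    1<2 : 1ℚ ℚ.< 2ℚ
    1<2 = subst (ℚ._< 2ℚ) (ℚₚ.+-identityʳ 1ℚ) (ℚₚ.+-monoʳ-< 1ℚ (ℚₚ.positive⁻¹ 1ℚ))

    advance : ∀ {a h} → 0ℚ ℚ.< h → Digits (h ℚ.+ h) a →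
              (a ℚ.+ h) ℚ.* (a ℚ.+ h) ℚ.≤ 2ℚ → Digits h (a ℚ.+ h)
    advance {a} {h} h>0 (1≤a , lo , hi) t²≤2 =
        ℚₚ.≤-trans 1≤a (subst (ℚ._≤ a ℚ.+ h) (ℚₚ.+-identityʳ a) (ℚₚ.+-monoʳ-≤ a (ℚₚ.<⇒≤ h>0)))
      , t²≤2
      , subst (λ b → 2ℚ ℚ.< b ℚ.* b) (sym (ℚₚ.+-assoc a h h)) hi

    √2-spec : ∀ n → Digits (½^ n) (√2-digits n)
    √2-spec zero = ℚₚ.≤-refl , ℚₚ.<⇒≤ 1<2 ,
      subst (ℚ._< 2ℚ ℚ.* 2ℚ) (ℚₚ.*-identityʳ 2ℚ) (ℚₚ.*-monoʳ-<-pos 2ℚ 1<2)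
    √2-spec (suc n) =
      if-does ((a ℚ.+ h) ℚ.* (a ℚ.+ h) ℚₚ.≤? 2ℚ) (Digits h)
        (advance (½^-pos (suc n)) (subst (λ k → Digits k a) (sym (halves (½^ n))) (√2-spec n)))
        (λ t²≰2 → proj₁ (√2-spec n) , proj₁ (proj₂ (√2-spec n)) , ℚₚ.≰⇒> t²≰2)
      where
      a h : ℚ
      a = √2-digits n
      h = ½^ (suc n)

    squares-gap : ∀ {a b h} → 0ℚ ℚ.< h → Digits h b → a ℚ.* a ℚ.≤ 2ℚ → a ℚ.< b ℚ.+ h
    squares-gap {a} {b} {h} h>0 (1≤b , _ , hi) a²≤2 = ℚₚ.≰⇒> λ b+h≤a →
      ℚₚ.<-irrefl refl (ℚₚ.<-≤-trans hi
        (ℚₚ.≤-trans (mul-mono-≤ b+h≥0 (ℚₚ.≤-trans b+h≥0 b+h≤a) b+h≤a b+h≤a) a²≤2))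
      where
      b+h≥0 : 0ℚ ℚ.≤ b ℚ.+ h
      b+h≥0 = ℚₚ.+-mono-≤ (ℚₚ.≤-trans (ℚₚ.<⇒≤ (ℚₚ.positive⁻¹ 1ℚ)) 1≤b) (ℚₚ.<⇒≤ h>0)

    <-shift : ∀ {a b h} → a ℚ.< b ℚ.+ h → a ℚ.- b ℚ.< h
    <-shift {a} {b} {h} p = subst (a ℚ.- b ℚ.<_)
      (solve 2 (λ b h → (b :+ h) :- b := h) refl b h) (ℚₚ.+-monoˡ-< (ℚ.- b) p)

    √2-gap : ∀ m n → √2-digits m ℚ.- √2-digits n ℚ.< ½^ n
    √2-gap m n = <-shift {√2-digits m} {√2-digits n} {½^ n}
      (squares-gap (½^-pos n) (√2-spec n) (proj₁ (proj₂ (√2-spec m))))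

    neg-diff : ∀ a b → b ℚ.- a ≡ ℚ.- (a ℚ.- b)
    neg-diff = solve 2 (λ a b → b :- a := :- (a :- b)) refl

    √2-cauchy : IsCauchy √2-digits
    √2-cauchy ε ε>0 =
      let N , f = ½^-small ε ε>0
      in N , λ m n p q → abs<
        (ℚₚ.<-trans (√2-gap m n) (f n q))
        (subst (ℚ._< ε) (neg-diff (√2-digits m) (√2-digits n))
          (ℚₚ.<-trans (√2-gap n m) (f m p)))

    5ℚ 1/5 : ℚ
    5ℚ = 2ℚ ℚ.+ 2ℚ ℚ.+ 1ℚ
    1/5 = ℤ.+ 1 ℚ./ 5

    fifths : ∀ ε → 5ℚ ℚ.* (1/5 ℚ.* ε) ≡ ε
    fifths = solve 1 (λ e → con 5ℚ :* (con 1/5 :* e) := e) refl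

    square-step : ∀ a h → (a ℚ.+ a ℚ.+ h) ℚ.* h ≡ (a ℚ.+ h) ℚ.* (a ℚ.+ h) ℚ.- a ℚ.* a
    square-step = solve 2 (λ a h → (a :+ a :+ h) :* h := (a :+ h) :* (a :+ h) :- a :* a) refl

    square-close : ∀ {a h ε} → 0ℚ ℚ.< h → h ℚ.≤ 1ℚ → a ℚ.≤ 2ℚ → Digits h a →
                   0ℚ ℚ.< ε → h ℚ.< 1/5 ℚ.* ε → ℚ.∣ a ℚ.* a ℚ.- 2ℚ ∣ ℚ.< ε
    square-close {a} {h} {ε} h>0 h≤1 a≤2 (_ , lo , hi) ε>0 small = abs<
      (ℚₚ.≤-<-trans (ℚₚ.+-monoˡ-≤ (ℚ.- 2ℚ) lo)
        (subst (ℚ._< ε) (sym (ℚₚ.+-inverseʳ 2ℚ)) ε>0))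
      (subst (ℚ._< ε) (neg-diff (a ℚ.* a) 2ℚ)
        (ℚₚ.<-trans (ℚₚ.+-monoˡ-< (ℚ.- (a ℚ.* a)) hi)
          (subst (ℚ._< ε) (square-step a h)
            (ℚₚ.≤-<-trans
              (ℚₚ.*-monoʳ-≤-nonNeg h {{ℚ.nonNegative (ℚₚ.<⇒≤ h>0)}}
                (ℚₚ.+-mono-≤ (ℚₚ.+-mono-≤ a≤2 a≤2) h≤1))
              (subst (5ℚ ℚ.* h ℚ.<_) (fifths ε) (ℚₚ.*-monoʳ-<-pos 5ℚ small))))))

√2 : ℝ
√2 = mkℝ √2-digits √2-cauchy

abstract
  √2-pos : 0ℝ < √2
  √2-pos = 1ℚ , ℚₚ.positive⁻¹ 1ℚ , 0 , λ n _ →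
    subst (ℚ._≤ √2-digits n) (sym (ℚₚ.+-identityˡ 1ℚ)) (proj₁ (√2-spec n))

  √2*√2≈2 : √2 * √2 ≈ fromℚ 2ℚ
  √2*√2≈2 ε ε>0 =
    let N , f = ½^-small (1/5 ℚ.* ε) (mul-pos (ℚₚ.positive⁻¹ 1/5) ε>0)
    in N , λ n p → square-close (½^-pos n) (½^-anti {0} {n} (ℕₚ.≤⇒≤′ ℕ.z≤n))
         (ℚₚ.<⇒≤ (squares-gap (½^-pos 0) (√2-spec 0) (proj₁ (proj₂ (√2-spec n)))))
         (√2-spec n) ε>0 (f n p)

record Mat₂ : Set where
  constructor mat
  field
    e₁₁ e₁₂ e₂₁ e₂₂ : ℝ

infixl 7 _·_
infix  4 _≃_

_·_ : Mat₂ → Mat₂ → Mat₂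
mat a b c d · mat a′ b′ c′ d′ =
  mat (a * a′ + b * c′) (a * b′ + b * d′)
      (c * a′ + d * c′) (c * b′ + d * d′)

_≈ᴹ_ : Mat₂ → Mat₂ → Set
mat a b c d ≈ᴹ mat a′ b′ c′ d′ = a ≈ a′ × b ≈ b′ × c ≈ c′ × d ≈ d′

negate adjugate : Mat₂ → Mat₂
negate   (mat a b c d) = mat (- a) (- b) (- c) (- d)
adjugate (mat a b c d) = mat d (- b) (- c) a

-- Equality in PSL₂(ℝ) of matrices of determinant 1.
_≃_ : Mat₂ → Mat₂ → Set
A ≃ B = (A ≈ᴹ B) ⊎ (A ≈ᴹ negate B)

-- The matrices whose class in PSL₂(ℝ) lies in the subgroup generated by the
-- classes of gen-T and gen-S.  All have determinant 1, so the adjugate is the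
-- inverse.
data H₄ : Mat₂ → Set where
  gen-T   : H₄ (mat 1ℝ √2 0ℝ 1ℝ)
  gen-S   : H₄ (mat 0ℝ (- 1ℝ) 1ℝ 0ℝ)
  unit    : H₄ (mat 1ℝ 0ℝ 0ℝ 1ℝ)
  product : ∀ {A B} → H₄ A → H₄ B → H₄ (A · B)
  inv     : ∀ {A} → H₄ A → H₄ (adjugate A)
  resp    : ∀ {A B} → A ≃ B → H₄ A → H₄ B

-- p/q in normalized form: (num , den) is the first column of a matrix in H₄
-- and den > 0, which excludes the point ∞.
record ℚH₄ : Set where
  field
    num den : ℝ
    col₂    : ∃[ r ] ∃[ s ] H₄ (mat num r den s)
    den>0   : 0ℝ < den

  value : ℝ
  value = num / den ⟨ den>0 ⟩

  den²>0 : 0ℝ < den * den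
  den²>0 = *-pos {den} {den} den>0 den>0

open ℚH₄ public

_IsBestApproximationOf_ : ℚH₄ → ℝ → Set
x IsBestApproximationOf α =
  ∀ (y : ℚH₄) → ¬ (value y ≈ value x) → den y ≤ den x →
  ∣ den x * α - num x ∣ < ∣ den y * α - num y ∣

½ℝ : ℝ
½ℝ = fromℚ ½

{-# OPTIONS --safe #-}
-- (i) Let X = qα - p, Y = sα - r for a matrix of H₄ with columns (p , q) and
-- (r , s), so that qY = sX + 1.  If 0 ≤ s ≤ q, then |X| < |Y| forces
-- -(q + s)X < 1, hence -qX < 1.  If q ≤ s ≤ √2q, the same conclusion comes
-- from the column √2(r , s) - (p , q), whose determinant with (p , q) is √2.
-- Powers of T bring s into [0 , √2q), and the column √2(p , q) - (r , s) gives
-- qX < 1 in the same way.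
--
-- (ii) The determinant of two columns of H₄ is an integer or √2 times an
-- integer, so for two different fractions it is at least 1 in absolute value;
-- hence q|Y| ≥ 1 - s|X| ≥ 1 - q|X| > 1/2 > q|X|.
--
-- Optimality: H₄ contains the matrices (d k ; k d) with d² - k² = 1 and k/√2
-- an integer.  The fractions k/d and d/k are equally good for α = 1, and
-- d²|1 - k/d| = d(d - k) = (1 + (d - k)²)/2 tends to 1/2.
module Submission where

open import Algebra.Bundles using (CommutativeRing)
import Algebra.Solver.Ring as RingSolver
open import Algebra.Solver.Ring.AlmostCommutativeRing
  using (fromCommutativeRing; _-Raw-AlmostCommutative⟶_)
open import Data.Bool.Base using (Bool; true; false; not; _xor_)
import Data.Bool.Properties as Boolₚ
open import Data.Empty using (⊥-elim)
open import Data.Integer.Base as ℤ using (ℤ)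
import Data.Integer.DivMod as ℤ
import Data.Integer.Properties as ℤₚ
open import Data.Maybe.Base using (Maybe; just; nothing)
open import Data.Nat.Base as ℕ using (ℕ; zero; suc)
open import Data.Nat.Coprimality as Coprimality using (Coprime)
import Data.Nat.Properties as ℕₚ
open import Data.Product.Base using (_×_; ∃-syntax; _,_; proj₂)
open import Data.Rational.Base as ℚ using (ℚ; 0ℚ; 1ℚ; ½)
import Data.Rational.Properties as ℚₚ
import Data.Rational.Solver as ℚSolver
import Data.Rational.Unnormalised.Base as ℚᵘ
import Data.Rational.Unnormalised.Properties as ℚᵘₚ
open import Data.Sum.Base as Sum using (_⊎_; inj₁; inj₂)
open import Level using (0ℓ)
open import Relation.Binary.Definitions using (tri<; tri≈; tri>)
open import Relation.Binary.PropositionalEquality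
  using (_≡_; refl; sym; trans; cong; cong₂; subst; subst₂)
open import Relation.Nullary using (¬_; yes; no)

-- The order of the reals is undecidable, yet the argument splits cases: s zero or positive, s ≤ q
-- or q ≤ s, fractions equal or not. Each of these is settled in the integers, because every entry
-- of a matrix of H₄ is n or √2n with n an integer; entries of different kinds are compared through
-- their squares, which are integers. The sign of X, which involves α, is never decided, and that of
-- Y only through the strict inequality |X| < |Y|. The estimates on X hold for both signs, being
-- identities whose right side is a sum of nonnegative terms.
--
-- Geometrically, (p , q), (r , s), √2(r , s) - (p , q) and √2(p , q) - (r , s) are, up to sign, the
-- four cusps of an ideal quadrilateral: neighbours have determinant 1, opposite ones √2. This is
-- where the second comparison column comes from: a neighbour with too large a denominator is
-- exchanged for the cusp opposite to p/q.

abstract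
  coprime-1 : ∀ n → Coprime n 1
  coprime-1 n = Coprimality.sym (Coprimality.1-coprimeTo n)

-- A literal normal form, so that `ℚ.toℚᵘ` computes on a variable `n`, and `fromℤ (ℤ.+ 0)` and
-- `fromℤ (ℤ.+ 1)` are `0ℚ` and `1ℚ` by computation. Later proofs by `≈-refl` and `<-irrefl` rely on
-- this.
fromℤ : ℤ → ℚ
fromℤ n = ℚ.mkℚ n 0 (coprime-1 ℤ.∣ n ∣)

fromℤ-homo-+ : ∀ m n → fromℤ (m ℤ.+ n) ≡ fromℤ m ℚ.+ fromℤ n
fromℤ-homo-+ m n = ℚₚ.toℚᵘ-injective (ℚᵘₚ.≃-trans
  (ℚᵘ.*≡* (cong (ℤ._* ℤ.+ 1) (sym (cong₂ ℤ._+_ (ℤₚ.*-identityʳ m) (ℤₚ.*-identityʳ n)))))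
  (ℚᵘₚ.≃-sym (ℚₚ.toℚᵘ-homo-+ (fromℤ m) (fromℤ n))))

fromℤ-homo-* : ∀ m n → fromℤ (m ℤ.* n) ≡ fromℤ m ℚ.* fromℤ n
fromℤ-homo-* m n = ℚₚ.toℚᵘ-injective
  (ℚᵘₚ.≃-sym (ℚₚ.toℚᵘ-homo-* (fromℤ m) (fromℤ n)))

fromℤ-homo‿- : ∀ n → fromℤ (ℤ.- n) ≡ ℚ.- fromℤ n
fromℤ-homo‿- n = ℚₚ.toℚᵘ-injective
  (ℚᵘₚ.≃-sym (ℚₚ.toℚᵘ-homo‿- (fromℤ n)))

fromℤ-mono-< : ∀ {m n} → m ℤ.< n → fromℤ m ℚ.< fromℤ n
fromℤ-mono-< {m} {n} m<n = ℚ.*<* (ℤₚ.*-monoʳ-<-pos (ℤ.+ 1) m<n)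

3ℚ : ℚ
3ℚ = 1ℚ ℚ.+ 1ℚ ℚ.+ 1ℚ

-- What remains of an ordered field without a decidable order: `<-cotrans` stands in for trichotomy,
-- `≤` is the negation of `<`, and `*-cancel-pos` does the work of division. Rational constants
-- enter through a homomorphism, so that the ring solver accepts coefficients such as ½. The carrier
-- is abstract because over `ℝ` the relations unfold to statements about sequences, which hampers
-- inference.
record OrderedRing : Set₁ where
  field
    commutativeRing : CommutativeRing 0ℓ 0ℓ
  open CommutativeRing commutativeRing public
    using (Carrier; _≈_; _+_; _*_; -_; _-_)
  infix 4 _<_
  field
    constants :
      CommutativeRing.rawRing ℚₚ.+-*-commutativeRing
        -Raw-AlmostCommutative⟶ fromCommutativeRing commutativeRing
    _<_ : Carrier → Carrier → Set
    ∣_∣ : Carrier → Carrier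

  open _-Raw-AlmostCommutative⟶_ constants public using () renaming (⟦_⟧ to ⌜_⌝)

  0R : Carrier
  0R = ⌜ 0ℚ ⌝

  1R : Carrier
  1R = ⌜ 1ℚ ⌝

  2R : Carrier
  2R = ⌜ 1ℚ ℚ.+ 1ℚ ⌝

  infix 4 _≤_
  _≤_ : Carrier → Carrier → Set
  x ≤ y = ¬ (y < x)

  field
    <-irrefl  : ∀ {x} → ¬ (x < x)
    <-trans   : ∀ {x y z} → x < y → y < z → x < z
    <-respˡ   : ∀ {x y z} → x ≈ y → x < z → y < z
    <-respʳ   : ∀ {x y z} → y ≈ z → x < y → x < z
    <-cotrans : ∀ {x y} → x < y → ∀ z → (x < z) ⊎ (z < y)
    ≤-antisym : ∀ {x y} → x ≤ y → y ≤ x → x ≈ y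
    +-monoˡ-< : ∀ {x y} z → x < y → (x + z) < (y + z)
    *-pos     : ∀ {x y} → 0R < x → 0R < y → 0R < (x * y)
    *-cancel-pos : ∀ {x y} → 0R < x → 0R < (x * y) → 0R < y
    ⌜⌝-mono-< : ∀ {p q} → p ℚ.< q → ⌜ p ⌝ < ⌜ q ⌝
    x≤∣x∣     : ∀ x → x ≤ ∣ x ∣
    -x≤∣x∣    : ∀ x → (- x) ≤ ∣ x ∣
    <∣∣       : ∀ {x z} → z < ∣ x ∣ → (z < x) ⊎ (z < (- x))
    ∣∣<       : ∀ {x z} → x < z → (- x) < z → ∣ x ∣ < z

-- Consequences of the ordered ring axioms.

module OrderedRingProperties (F : OrderedRing) where
  open OrderedRing F
  open CommutativeRing commutativeRing using (+-cong; +-congˡ; +-congʳ; *-cong; *-congʳ; *-assoc; -‿cong)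
    renaming (refl to ≈-refl; sym to ≈-sym; trans to ≈-trans)

  private
    constants-≟ : ∀ p q → Maybe (⌜ p ⌝ ≈ ⌜ q ⌝)
    constants-≟ p q with p ℚₚ.≟ q
    ... | yes refl = just ≈-refl
    ... | no  _    = nothing

  open RingSolver (CommutativeRing.rawRing ℚₚ.+-*-commutativeRing)
    (fromCommutativeRing commutativeRing) constants constants-≟ public
    using (solve; _:=_; _:+_; _:*_; _:-_; :-_; con)

  private
    variable
      a b c d p q r s u v x y z α θ D X Y Z : Carrier

  ≤-respʳ : y ≈ z → x ≤ y → x ≤ z
  ≤-respʳ y≈z x≤y z<x = x≤y (<-respˡ (≈-sym y≈z) z<x)

  ≤-respˡ : x ≈ y → x ≤ z → y ≤ z
  ≤-respˡ x≈y x≤z z<y = x≤z (<-respʳ (≈-sym x≈y) z<y)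

  <⇒≤ : x < y → x ≤ y
  <⇒≤ x<y y<x = <-irrefl (<-trans x<y y<x)

  ≤-<-trans : x ≤ y → y < z → x < z
  ≤-<-trans {x = x} x≤y y<z with <-cotrans y<z x
  ... | inj₁ y<x = ⊥-elim (x≤y y<x)
  ... | inj₂ x<z = x<z

  <-≤-trans : x < y → y ≤ z → x < z
  <-≤-trans {z = z} x<y y≤z with <-cotrans x<y z
  ... | inj₁ x<z = x<z
  ... | inj₂ z<y = ⊥-elim (y≤z z<y)

  ≤-trans : x ≤ y → y ≤ z → x ≤ z
  ≤-trans x≤y y≤z z<x = x≤y (≤-<-trans y≤z z<x)

  <⇒0<diff : a < b → 0R < b - a
  <⇒0<diff {a} {b} a<b = <-respˡ (solve 1 (λ a → a :+ :- a := con 0ℚ) ≈-refl a) (+-monoˡ-< (- a) a<b)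

  0<diff⇒< : 0R < b - a → a < b
  0<diff⇒< {b} {a} h = <-respˡ (solve 1 (λ a → con 0ℚ :+ a := a) ≈-refl a)
    (<-respʳ (solve 2 (λ a b → b :- a :+ a := b) ≈-refl a b) (+-monoˡ-< a h))

  ≤⇒0≤diff : a ≤ b → 0R ≤ b - a
  ≤⇒0≤diff {a} {b} a≤b h = a≤b (<-respˡ (solve 2 (λ a b → b :- a :+ a := b) ≈-refl a b)
    (<-respʳ (solve 1 (λ a → con 0ℚ :+ a := a) ≈-refl a) (+-monoˡ-< a h)))

  0≤diff⇒≤ : 0R ≤ b - a → a ≤ b
  0≤diff⇒≤ {b} {a} h b<a =
    h (<-respʳ (solve 1 (λ a → a :+ :- a := con 0ℚ) ≈-refl a) (+-monoˡ-< (- a) b<a))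

  +-nonNeg-pos : 0R ≤ x → 0R < y → 0R < x + y
  +-nonNeg-pos {x} {y} x≥0 y>0 with <-cotrans y>0 (x + y)
  ... | inj₁ h = h
  ... | inj₂ h = ⊥-elim (x≥0 (<-respˡ (solve 2 (λ x y → x :+ y :- y := x) ≈-refl x y)
    (<-respʳ (solve 1 (λ a → a :- a := con 0ℚ) ≈-refl y) (+-monoˡ-< (- y) h))))

  +-pos : 0R < x → 0R < y → 0R < x + y
  +-pos x>0 = +-nonNeg-pos (<⇒≤ x>0)

  +-nonNeg : 0R ≤ x → 0R ≤ y → 0R ≤ x + y
  +-nonNeg {x} {y} x≥0 y≥0 h with <-cotrans h y
  ... | inj₂ y<0 = y≥0 y<0
  ... | inj₁ h′  = x≥0 (<-respˡ (solve 2 (λ x y → x :+ y :- y := x) ≈-refl x y)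
    (<-respʳ (solve 1 (λ a → a :- a := con 0ℚ) ≈-refl y) (+-monoˡ-< (- y) h′)))

  -- A nonnegative element cannot be split into zero or positive. But if xy < 0, then 0 < x is
  -- impossible, since cancelling x would make y negative; so x ≈ 0 by antisymmetry, and the product
  -- vanishes.
  *-nonNeg : 0R ≤ x → 0R ≤ y → 0R ≤ x * y
  *-nonNeg {x} {y} x≥0 y≥0 xy<0 = <-irrefl (<-respˡ xy≈0 xy<0)
    where
    x≯0 : ¬ 0R < x
    x≯0 x>0 = y≥0 (0<diff⇒< (<-respʳ (solve 1 (λ y → :- y := con 0ℚ :- y) ≈-refl y)
      (*-cancel-pos x>0 (<-respʳ (solve 2 (λ x y → con 0ℚ :- x :* y := x :* :- y) ≈-refl x y)
        (<⇒0<diff xy<0)))))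
    xy≈0 : x * y ≈ 0R
    xy≈0 = ≈-trans (*-congʳ (≤-antisym x≯0 x≥0)) (solve 1 (λ y → con 0ℚ :* y := con 0ℚ) ≈-refl y)

  -- Reduces x ≈ y to an identity of polynomials; w is the cofactor of u - v.
  modulo : u ≈ v → ∀ w → x + (u - v) * w ≈ y → x ≈ y
  modulo {u} {v} {x} u≈v w h = ≈-trans (≈-sym (≈-trans (+-congˡ (*-congʳ (+-congʳ u≈v)))
    (solve 3 (λ v x w → x :+ (v :- v) :* w := x) ≈-refl v x w))) h

  0<1 : 0R < 1R
  0<1 = ⌜⌝-mono-< (ℚₚ.positive⁻¹ 1ℚ)

  0≤1 : 0R ≤ 1R
  0≤1 = <⇒≤ 0<1

  0<2 : 0R < 2R
  0<2 = ⌜⌝-mono-< (ℚₚ.positive⁻¹ (1ℚ ℚ.+ 1ℚ))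

  *-monoˡ-< : 0R < z → x < y → z * x < z * y
  *-monoˡ-< {z} {x} {y} z>0 x<y = 0<diff⇒< (<-respʳ
    (solve 3 (λ x y z → z :* (y :- x) := z :* y :- z :* x) ≈-refl x y z) (*-pos z>0 (<⇒0<diff x<y)))

  *-cancelˡ-< : 0R < z → z * x < z * y → x < y
  *-cancelˡ-< {z} {x} {y} z>0 h = 0<diff⇒< (*-cancel-pos z>0 (<-respʳ
    (solve 3 (λ x y z → z :* y :- z :* x := z :* (y :- x)) ≈-refl x y z) (<⇒0<diff h)))

  square-reflects-≤ : 0R ≤ x → 0R ≤ y → x * x ≤ y * y → x ≤ y
  square-reflects-≤ {x} {y} x≥0 y≥0 h y<x = h (0<diff⇒< (<-respʳ
    (solve 2 (λ x y → (x :- y) :* (y :+ x) := x :* x :- y :* y) ≈-refl x y)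
    (*-pos (<⇒0<diff y<x) (+-nonNeg-pos y≥0 (≤-<-trans y≥0 y<x)))))

  -- Estimates from a single comparison column.

  1<√2 : 0R < θ → θ * θ ≈ 2R → 1R < θ
  1<√2 {θ} θ>0 θ²≈2 = 0<diff⇒< (*-cancel-pos (+-pos θ>0 0<1)
    (<-respʳ (modulo θ²≈2 1R
      (solve 1 (λ θ → con 1ℚ :+ (θ :* θ :- con (1ℚ ℚ.+ 1ℚ)) :* con 1ℚ := (θ :+ con 1ℚ) :* (θ :- con 1ℚ)) ≈-refl θ)) 0<1))

  -- Holds for `z` of either sign, because p(1 - qz) = (p - q) + q(1 - pz). Thus the factor q + s
  -- can be lowered to q without deciding the sign of X.
  bound-antitone : 0R < q → q ≤ p → p * z < 1R → q * z < 1R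
  bound-antitone {q} {p} {z} q>0 q≤p pz<1 = 0<diff⇒< (*-cancel-pos p>0
    (<-respʳ (solve 3 (λ q p z → (p :- q) :+ q :* (con 1ℚ :- p :* z) := p :* (con 1ℚ :- q :* z))
        ≈-refl q p z)
      (+-nonNeg-pos (≤⇒0≤diff q≤p) (*-pos q>0 (<⇒0<diff pz<1)))))
    where
    p>0 = <-≤-trans q>0 q≤p

  -- `Z` stands for |X| and is known only through these two bounds, whose sum gives 0 ≤ 2Z. The pair
  -- is symmetric in X and -X, so each estimate below serves both sides of p/q.
  nonNeg-of-bounds : X ≤ Z → (- X) ≤ Z → 0R ≤ Z
  nonNeg-of-bounds {X} {Z} X≤Z -X≤Z Z<0 = +-nonNeg (≤⇒0≤diff X≤Z) (≤⇒0≤diff -X≤Z)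
    (0<diff⇒< (<-respʳ
      (solve 2 (λ X Z → (con 0ℚ :- Z) :+ (con 0ℚ :- Z) := con 0ℚ :- ((Z :- X) :+ (Z :- :- X))) ≈-refl X Z)
      (+-pos (<⇒0<diff Z<0) (<⇒0<diff Z<0))))

  <∣∣-negate : (Z < Y) ⊎ (Z < (- Y)) → (Z < (- Y)) ⊎ (Z < (- - Y))
  <∣∣-negate (inj₁ h) = inj₂ (<-respʳ (solve 1 (λ Y → Y := :- :- Y) ≈-refl _) h)
  <∣∣-negate (inj₂ h) = inj₁ h

  ≤-neg-neg : X ≤ Z → (- - X) ≤ Z
  ≤-neg-neg = ≤-respˡ (solve 1 (λ X → X := :- :- X) ≈-refl _)

  -- With X = qα - p, Y = sα - r and D = ps - qr.
  one-sided-bound : 0R < q → 0R ≤ s → s ≤ q → 0R < D → q * Y ≈ s * X + D →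
    X ≤ Z → (- X) ≤ Z → (Z < Y) ⊎ (Z < (- Y)) → (q + s) * (- X) < D
  one-sided-bound {q} {s} {D} {Y} {X} {Z} q>0 s≥0 s≤q D>0 e X≤Z -X≤Z (inj₁ Z<Y) =
    0<diff⇒< (<-respʳ
      (modulo e (- 1R) (solve 5 (λ q s D X Y →
        q :* (Y :- :- X) :+ (q :* Y :- (s :* X :+ D)) :* (:- con 1ℚ) := D :- (q :+ s) :* (:- X))
        ≈-refl q s D X Y))
      (*-pos q>0 (<⇒0<diff (≤-<-trans -X≤Z Z<Y))))
  -- The impossible sign: q(-Y) = s(-X) - D ≤ sZ - D < qZ contradicts Z < -Y.
  one-sided-bound {q} {s} {D} {Y} {X} {Z} q>0 s≥0 s≤q D>0 e X≤Z -X≤Z (inj₂ Z<-Y) =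
    ⊥-elim (<-irrefl (<-respʳ
      (modulo e 1R (solve 6 (λ q s D X Y Z →
        ((q :- s) :* Z :+ s :* (Z :- :- X)) :+ (D :+ q :* (:- Y :- Z)) :+ (q :* Y :- (s :* X :+ D)) :* con 1ℚ
          := con 0ℚ)
        ≈-refl q s D X Y Z))
      (+-nonNeg-pos
        (+-nonNeg (*-nonNeg (≤⇒0≤diff s≤q) (nonNeg-of-bounds X≤Z -X≤Z))
                  (*-nonNeg s≥0 (≤⇒0≤diff -X≤Z)))
        (+-pos D>0 (*-pos q>0 (<⇒0<diff Z<-Y))))))

  module _ (q>0 : 0R < q) (X≤Z : X ≤ Z) (-X≤Z : (- X) ≤ Z) where

    near-bound : 0R ≤ s → s ≤ q → q * Y ≈ s * X + 1R →
      (Z < Y) ⊎ (Z < (- Y)) → q * (- X) < 1R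
    near-bound {s} s≥0 s≤q e h = bound-antitone q>0
      (0≤diff⇒≤ (≤-respʳ (solve 2 (λ q s → s := (q :+ s) :- q) ≈-refl _ s) s≥0))
      (one-sided-bound q>0 s≥0 s≤q 0<1 e X≤Z -X≤Z h)

    -- The far column has determinant θ, but its denominator and q add up to θs. So
    -- `one-sided-bound` says θs(-X) < θ, the factor θ cancels, and q ≤ s lowers s(-X) < 1 to q(-X)
    -- < 1.
    far-bound : 0R < θ → θ * θ ≈ 2R → 0R ≤ θ * s - q → θ * s - q ≤ q → q ≤ s →
      q * Y ≈ (θ * s - q) * X + θ → (Z < Y) ⊎ (Z < (- Y)) → q * (- X) < 1R
    far-bound {θ} {s} θ>0 θ²≈2 f≥0 f≤q q≤s e h = bound-antitone q>0 q≤s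
      (*-cancelˡ-< θ>0 (<-respʳ (solve 1 (λ θ → θ := θ :* con 1ℚ) ≈-refl θ)
        (<-respˡ (solve 4 (λ q s θ X → (q :+ (θ :* s :- q)) :* (:- X) := θ :* (s :* (:- X)))
            ≈-refl _ s θ _)
          (one-sided-bound q>0 f≥0 f≤q θ>0 e X≤Z -X≤Z h))))

  module _ (θ>0 : 0R < θ) (θ²≈2 : θ * θ ≈ 2R) where

    far-pos : 0R < q → q ≤ s → 0R < θ * s - q
    far-pos {q} {s} q>0 q≤s = <-respʳ
      (solve 3 (λ q s θ → θ :* (s :- q) :+ q :* (θ :- con 1ℚ) := θ :* s :- q) ≈-refl q s θ)
      (+-nonNeg-pos (*-nonNeg (<⇒≤ θ>0) (≤⇒0≤diff q≤s)) (*-pos q>0 (<⇒0<diff (1<√2 θ>0 θ²≈2))))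

    -- Since θ² = 2, q - (θs - q) = θ(θq - s): the bound θq on s is exactly what keeps the far
    -- denominator at most q.
    far-≤ : s ≤ θ * q → θ * s - q ≤ q
    far-≤ {s} {q} s≤θq = 0≤diff⇒≤ (≤-respʳ
      (modulo θ²≈2 (- q) (solve 3 (λ q s θ →
        θ :* (θ :* q :- s) :+ (θ :* θ :- con (1ℚ ℚ.+ 1ℚ)) :* (:- q) := q :- (θ :* s :- q)) ≈-refl q s θ))
      (*-nonNeg (<⇒≤ θ>0) (≤⇒0≤diff s≤θq)))

  column-relation : ∀ α → p * s - q * r ≈ D → q * (s * α - r) ≈ s * (q * α - p) + D
  column-relation {p} {s} {q} {r} {D} α det = modulo det (- 1R) (solve 6 (λ α p q r s D →
    q :* (s :* α :- r) :+ ((p :* s :- q :* r) :- D) :* (:- con 1ℚ) := s :* (q :* α :- p) :+ D)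
    ≈-refl α p q r s D)

  -- Mirror image of `column-relation`: with the columns exchanged, X and Y change sign, so the same
  -- one-sided estimates bound qX from above.
  column-relation⁻ : ∀ α → r * q - s * p ≈ D → q * (- (s * α - r)) ≈ s * (- (q * α - p)) + D
  column-relation⁻ {r} {q} {s} {p} {D} α det = modulo det (- 1R) (solve 6 (λ α p q r s D →
    q :* (:- (s :* α :- r)) :+ ((r :* q :- s :* p) :- D) :* (:- con 1ℚ) := s :* (:- (q :* α :- p)) :+ D)
    ≈-refl α p q r s D)

  far-det : p * s - q * r ≈ 1R → p * (θ * s - q) - q * (θ * r - p) ≈ θ
  far-det {p} {s} {q} {r} {θ} det = modulo det (- θ) (solve 5 (λ p q r s θ →
    (p :* (θ :* s :- q) :- q :* (θ :* r :- p)) :+ ((p :* s :- q :* r) :- con 1ℚ) :* (:- θ) := θ)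
    ≈-refl p q r s θ)

  far-det⁻ : r * q - s * p ≈ 1R → (θ * r - p) * q - (θ * s - q) * p ≈ θ
  far-det⁻ {r} {q} {s} {p} {θ} det = modulo det (- θ) (solve 5 (λ p q r s θ →
    ((θ :* r :- p) :* q :- (θ :* s :- q) :* p) :+ ((r :* q :- s :* p) :- con 1ℚ) :* (:- θ) := θ)
    ≈-refl p q r s θ)

  det-nonzero : 0R < D → p * s - q * r ≈ D → ¬ (p * s - q * r ≈ 0R)
  det-nonzero D>0 e h = <-irrefl (<-respʳ (≈-trans (≈-sym e) h) D>0)

  det-nonzero⁻ : 0R < D → r * q - s * p ≈ D → ¬ (p * s - q * r ≈ 0R)
  det-nonzero⁻ {D} {r} {q} {s} {p} D>0 e h = <-irrefl (<-respʳ
    (modulo e 1R (modulo h 1R (solve 5 (λ p q r s D → D :+ ((r :* q :- s :* p) :- D) :* con 1ℚ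
      :+ ((p :* s :- q :* r) :- con 0ℚ) :* con 1ℚ := con 0ℚ) ≈-refl p q r s D))) D>0)

  -- Fractions closer than 1/(2q²), and clearing denominators.

  private
    ½R : Carrier
    ½R = ⌜ ½ ⌝

  -- With X = qα - p, Y = sα - r and D = ps - qr.
  close-beats : 0R < q → 0R ≤ s → s ≤ q → 1R ≤ D → q * Y ≈ s * X + D →
    X ≤ Z → (- X) ≤ Z → q * Z < ½R → Z < Y
  close-beats {q} {s} {D} {Y} {X} {Z} q>0 s≥0 s≤q 1≤D e X≤Z -X≤Z qZ<½ =
    0<diff⇒< (*-cancel-pos q>0 (<-respʳ
      (modulo e 1R (solve 6 (λ q s D X Y Z →
        ((D :- con 1ℚ) :+ (s :* (Z :- :- X) :+ (q :- s) :* Z))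
          :+ ((con ½ :- q :* Z) :+ (con ½ :- q :* Z)) :+ (q :* Y :- (s :* X :+ D)) :* con 1ℚ
          := q :* (Y :- Z)) ≈-refl q s D X Y Z))
      (+-nonNeg-pos
        (+-nonNeg (≤⇒0≤diff 1≤D) (+-nonNeg (*-nonNeg s≥0 (≤⇒0≤diff -X≤Z))
          (*-nonNeg (≤⇒0≤diff s≤q) (nonNeg-of-bounds X≤Z -X≤Z))))
        (+-pos (<⇒0<diff qZ<½) (<⇒0<diff qZ<½)))))

  close-is-best : 0R < q → 0R ≤ s → s ≤ q → q * ∣ q * α - p ∣ < ½R →
    (1R ≤ p * s - q * r) ⊎ (1R ≤ - (p * s - q * r)) → ∣ q * α - p ∣ < ∣ s * α - r ∣
  close-is-best {q} {s} {α} {p} {r} q>0 s≥0 s≤q h (inj₁ 1≤D) = <-≤-trans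
    (close-beats q>0 s≥0 s≤q 1≤D (column-relation α ≈-refl) (x≤∣x∣ _) (-x≤∣x∣ _) h) (x≤∣x∣ _)
  close-is-best {q} {s} {α} {p} {r} q>0 s≥0 s≤q h (inj₂ 1≤-D) = <-≤-trans
    (close-beats q>0 s≥0 s≤q 1≤-D (column-relation⁻ α
      (solve 4 (λ p q r s → r :* q :- s :* p := :- (p :* s :- q :* r)) ≈-refl p q r s))
      (-x≤∣x∣ _) (≤-neg-neg (x≤∣x∣ _)) h) (-x≤∣x∣ _)

  not-closer-than-opposite : Y ≈ - X → ¬ (∣ X ∣ < ∣ Y ∣)
  not-closer-than-opposite {Y} {X} e h with <∣∣ h
  ... | inj₁ h′ = -x≤∣x∣ X (<-respʳ e h′)
  ... | inj₂ h′ = x≤∣x∣ X (<-respʳ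
    (modulo e 1R (solve 2 (λ X Y → :- Y :+ (Y :- :- X) :* con 1ℚ := X) ≈-refl X Y)) h′)

  -- `u` and `w` are 1/q and 1/q², given by their defining equations since the ring has no division.
  -- The module passes between |α - p/q| < c/q² and q|qα - p| < c, the form in which the columns are
  -- handled.
  module Quotient {α p q u w : Carrier} (q>0 : 0R < q) (qu≈1 : q * u ≈ 1R) (qqw≈1 : q * q * w ≈ 1R) where

    private
      ξ : Carrier
      ξ = q * α - p

    ∣α-p/q∣< : ∀ {c} → q * ξ < c → q * (- ξ) < c → ∣ α - p * u ∣ < c * w
    ∣α-p/q∣< {c} h h′ = ∣∣<
      (0<diff⇒< (*-cancel-pos (*-pos q>0 q>0) (<-respʳ
        (modulo qu≈1 (q * p) (modulo qqw≈1 c (solve 6 (λ α p q u w c →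
          (c :- q :* (q :* α :- p)) :+ (q :* u :- con 1ℚ) :* (q :* p) :+ (q :* q :* w :- con 1ℚ) :* c
            := q :* q :* (c :* w :- (α :- p :* u))) ≈-refl α p q u w c)))
        (<⇒0<diff h))))
      (0<diff⇒< (*-cancel-pos (*-pos q>0 q>0) (<-respʳ
        (modulo qu≈1 (- (q * p)) (modulo qqw≈1 c (solve 6 (λ α p q u w c →
          (c :- q :* (:- (q :* α :- p))) :+ (q :* u :- con 1ℚ) :* (:- (q :* p)) :+ (q :* q :* w :- con 1ℚ) :* c
            := q :* q :* (c :* w :- (:- (α :- p :* u)))) ≈-refl α p q u w c)))
        (<⇒0<diff h′))))

    q∣qα-p∣< : ∀ {c} → ∣ α - p * u ∣ < c * w → q * ∣ ξ ∣ < c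
    q∣qα-p∣< {c} h = <-respʳ
      (modulo qu≈1 (- c) (solve 3 (λ q u c →
        q :* (c :* u) :+ (q :* u :- con 1ℚ) :* (:- c) := c) ≈-refl q u c))
      (*-monoˡ-< q>0 (∣∣<
        (0<diff⇒< (*-cancel-pos q>0 (<-respʳ
          (modulo qu≈1 (c - q * p) (modulo qqw≈1 (- c) (solve 6 (λ α p q u w c →
            q :* q :* (c :* w :- (α :- p :* u)) :+ (q :* u :- con 1ℚ) :* (c :- q :* p)
              :+ (q :* q :* w :- con 1ℚ) :* (:- c)
              := q :* (c :* u :- (q :* α :- p))) ≈-refl α p q u w c)))
          (*-pos (*-pos q>0 q>0) (<⇒0<diff (≤-<-trans (x≤∣x∣ (α - p * u)) h))))))
        (0<diff⇒< (*-cancel-pos q>0 (<-respʳ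
          (modulo qu≈1 (c + q * p) (modulo qqw≈1 (- c) (solve 6 (λ α p q u w c →
            q :* q :* (c :* w :- (:- (α :- p :* u))) :+ (q :* u :- con 1ℚ) :* (c :+ q :* p)
              :+ (q :* q :* w :- con 1ℚ) :* (:- c)
              := q :* (c :* u :- (:- (q :* α :- p)))) ≈-refl α p q u w c)))
          (*-pos (*-pos q>0 q>0) (<⇒0<diff (≤-<-trans (-x≤∣x∣ (α - p * u)) h))))))))

  -- Solutions of d² - k² = 1.

  module Pell {d k : Carrier} (d>0 : 0R < d) (k>0 : 0R < k) (pell : d * d - k * k ≈ 1R) where

    gap-pos : 0R < d - k
    gap-pos = *-cancel-pos (+-pos d>0 k>0) (<-respʳ (modulo pell 1R (solve 2 (λ d k →
      con 1ℚ :+ ((d :* d :- k :* k) :- con 1ℚ) :* con 1ℚ := (d :+ k) :* (d :- k)) ≈-refl d k)) 0<1)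

    -- As d(d - k) = (1 + (d - k)²)/2, it remains to see (d - k)² < 2ε. This follows after
    -- multiplication by d², from d²(d - k)² < 1 and 1 ≤ d²ε; the latter holds because 1 ≤ n ≤ d and
    -- 1 ≤ nε.
    gap-small : ∀ {ε n} → 0R < ε → 1R ≤ n → n ≤ d → 1R ≤ n * ε → d * (d - k) < ½R + ε
    gap-small {ε} {n} ε>0 1≤n n≤d 1≤nε = 0<diff⇒< (<-respʳ
      (modulo pell (- ½R) (solve 3 (λ d k ε →
        con ½ :* (ε :+ ε :- (d :- k) :* (d :- k)) :+ ((d :* d :- k :* k) :- con 1ℚ) :* (:- con ½)
          := (con ½ :+ ε) :- d :* (d :- k)) ≈-refl d k ε))
      (*-pos (⌜⌝-mono-< (ℚₚ.positive⁻¹ ½)) gap²<2ε))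
      where
      d²ε≥1 : 0R ≤ d * d * ε - 1R
      d²ε≥1 = ≤-respʳ
        (solve 3 (λ d ε n → d :* ((d :- n) :* ε :+ (n :* ε :- con 1ℚ)) :+ ((d :- n) :+ (n :- con 1ℚ))
          := d :* d :* ε :- con 1ℚ) ≈-refl d ε n)
        (+-nonNeg (*-nonNeg (<⇒≤ d>0)
            (+-nonNeg (*-nonNeg (≤⇒0≤diff n≤d) (<⇒≤ ε>0)) (≤⇒0≤diff 1≤nε)))
          (+-nonNeg (≤⇒0≤diff n≤d) (≤⇒0≤diff 1≤n)))
      -- By the Pell equation k(d - k) = 1 - d(d - k), so this product is 1 - d²(d - k)².
      1-d²gap²>0 : 0R < (k * (d - k)) * (1R + d * (d - k))
      1-d²gap²>0 = *-pos (*-pos k>0 gap-pos) (+-pos 0<1 (*-pos d>0 gap-pos))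
      gap²<2ε : 0R < ε + ε - (d - k) * (d - k)
      gap²<2ε = *-cancel-pos (*-pos d>0 d>0) (<-respʳ
        (modulo pell (- (1R + d * (d - k))) (solve 3 (λ d k ε →
          (d :* d :* ε :- con 1ℚ) :+ (d :* d :* ε :- con 1ℚ)
            :+ (con 1ℚ :+ k :* (d :- k) :* (con 1ℚ :+ d :* (d :- k)))
            :+ ((d :* d :- k :* k) :- con 1ℚ) :* (:- (con 1ℚ :+ d :* (d :- k)))
            := d :* d :* (ε :+ ε :- (d :- k) :* (d :- k))) ≈-refl d k ε))
        (+-nonNeg-pos (+-nonNeg d²ε≥1 d²ε≥1) (+-pos 0<1 1-d²gap²>0)))

    gap<⇒ : ∀ {c} → d * (d - k) < c → d * (d * 1R - k) < c × d * (- (d * 1R - k)) < c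
    gap<⇒ {c} h = <-respˡ (solve 2 (λ d k → d :* (d :- k) := d :* (d :* con 1ℚ :- k)) ≈-refl d k) h
      , <-trans (0<diff⇒< (<-respʳ (solve 2 (λ d k → d :* (d :- k) :+ d :* (d :- k)
            := d :* (d :- k) :- d :* (:- (d :* con 1ℚ :- k))) ≈-refl d k) (+-pos de>0 de>0))) h
      where
      de>0 : 0R < d * (d - k)
      de>0 = *-pos d>0 gap-pos

    equidistant : ¬ (∣ d * 1R - k ∣ < ∣ k * 1R - d ∣)
    equidistant = not-closer-than-opposite
      (solve 2 (λ d k → k :* con 1ℚ :- d := :- (d :* con 1ℚ :- k)) ≈-refl d k)

    det≢0 : ¬ (k * k - d * d ≈ 0R)
    det≢0 = det-nonzero⁻ 0<1 pell

  -- Right multiplication by (3 2√2 ; 2√2 3) = T S T² S T on the row (a b).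
  module PellStep (θ²≈2 : θ * θ ≈ 2R) where

    stepˡ : ∀ a b → (- a + θ * (b + θ * a)) + θ * (b + θ * a) ≈ ⌜ 3ℚ ⌝ * a + 2R * θ * b
    stepˡ a b = modulo θ²≈2 (- (2R * a)) (solve 3 (λ a b θ →
      ((:- a :+ θ :* (b :+ θ :* a)) :+ θ :* (b :+ θ :* a)) :+ (θ :* θ :- con (1ℚ ℚ.+ 1ℚ)) :* (:- (con (1ℚ ℚ.+ 1ℚ) :* a))
        := con 3ℚ :* a :+ con (1ℚ ℚ.+ 1ℚ) :* θ :* b) ≈-refl a b θ)

    stepʳ : ∀ a b → - (b + θ * a) + θ * ((- a + θ * (b + θ * a)) + θ * (b + θ * a))
      ≈ ⌜ 3ℚ ⌝ * b + 2R * θ * a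
    stepʳ a b = modulo θ²≈2 (- (2R * b + 2R * θ * a)) (solve 3 (λ a b θ →
      (:- (b :+ θ :* a) :+ θ :* ((:- a :+ θ :* (b :+ θ :* a)) :+ θ :* (b :+ θ :* a)))
        :+ (θ :* θ :- con (1ℚ ℚ.+ 1ℚ)) :* (:- (con (1ℚ ℚ.+ 1ℚ) :* b :+ con (1ℚ ℚ.+ 1ℚ) :* θ :* a))
        := con 3ℚ :* b :+ con (1ℚ ℚ.+ 1ℚ) :* θ :* a) ≈-refl a b θ)

    module _ {d k : Carrier} (θ>0 : 0R < θ) (d≥1 : 1R ≤ d) (k≥0 : 0R ≤ k) where

      step-k>0 : 0R < ⌜ 3ℚ ⌝ * k + 2R * θ * d
      step-k>0 = +-nonNeg-pos (*-nonNeg (<⇒≤ (⌜⌝-mono-< (ℚₚ.positive⁻¹ 3ℚ))) k≥0)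
        (*-pos (*-pos 0<2 θ>0) (<-≤-trans 0<1 d≥1))

      step-d : ∀ {n} → n ≤ d → 1R + n ≤ ⌜ 3ℚ ⌝ * d + 2R * θ * k
      step-d {n} n≤d = 0≤diff⇒≤ (≤-respʳ (solve 4 (λ d k n θ →
          (d :- n) :+ (d :- con 1ℚ) :+ (d :+ con (1ℚ ℚ.+ 1ℚ) :* θ :* k)
            := con 3ℚ :* d :+ con (1ℚ ℚ.+ 1ℚ) :* θ :* k :- (con 1ℚ :+ n)) ≈-refl d k n θ)
        (+-nonNeg (+-nonNeg (≤⇒0≤diff n≤d) (≤⇒0≤diff d≥1))
          (+-nonNeg (<⇒≤ (<-≤-trans 0<1 d≥1)) (*-nonNeg (<⇒≤ (*-pos 0<2 θ>0)) k≥0))))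

  -- Determinants: equality of fractions, and invariance under the group rules.

  equal-quotients : p * s - q * r ≈ 0R → q * u ≈ 1R → s * v ≈ 1R → r * v ≈ p * u
  equal-quotients {p} {s} {q} {r} {u} {v} det qu≈1 sv≈1 =
    modulo det (u * v) (modulo qu≈1 (r * v) (modulo sv≈1 (- (p * u)) (solve 6 (λ p q r s u v →
      r :* v :+ ((p :* s :- q :* r) :- con 0ℚ) :* (u :* v) :+ (q :* u :- con 1ℚ) :* (r :* v)
        :+ (s :* v :- con 1ℚ) :* (:- (p :* u)) := p :* u) ≈-refl p q r s u v)))

  det-of-equal-quotients : r * v ≈ p * u → q * u ≈ 1R → s * v ≈ 1R → p * s - q * r ≈ 0R
  det-of-equal-quotients {r} {v} {p} {u} {q} {s} e qu≈1 sv≈1 =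
    modulo e (q * s) (modulo qu≈1 (p * s) (modulo sv≈1 (- (q * r)) (solve 6 (λ p q r s u v →
      (p :* s :- q :* r) :+ (r :* v :- p :* u) :* (q :* s) :+ (q :* u :- con 1ℚ) :* (p :* s)
        :+ (s :* v :- con 1ℚ) :* (:- (q :* r)) := con 0ℚ) ≈-refl p q r s u v)))

  det-product : ∀ {a b c d a′ b′ c′ d′} → a * d - c * b ≈ 1R → a′ * d′ - c′ * b′ ≈ 1R →
    (a * a′ + b * c′) * (c * b′ + d * d′) - (c * a′ + d * c′) * (a * b′ + b * d′) ≈ 1R
  det-product {a} {b} {c} {d} {a′} {b′} {c′} {d′} h h′ =
    modulo h (- (a′ * d′ - c′ * b′)) (modulo h′ (- 1R) (solve 8 (λ a b c d a′ b′ c′ d′ →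
      ((a :* a′ :+ b :* c′) :* (c :* b′ :+ d :* d′) :- (c :* a′ :+ d :* c′) :* (a :* b′ :+ b :* d′))
        :+ ((a :* d :- c :* b) :- con 1ℚ) :* (:- (a′ :* d′ :- c′ :* b′))
        :+ ((a′ :* d′ :- c′ :* b′) :- con 1ℚ) :* (:- con 1ℚ) := con 1ℚ)
      ≈-refl a b c d a′ b′ c′ d′))

  negate-swap : x ≈ - y → - x ≈ y
  negate-swap {x} {y} e = modulo e 1R (solve 2 (λ x y → :- x :+ (x :- :- y) :* con 1ℚ := y) ≈-refl x y)

  det-resp : ∀ {a b c d a′ b′ c′ d′} → a ≈ a′ → b ≈ b′ → c ≈ c′ → d ≈ d′ →
    a * d - c * b ≈ 1R → a′ * d′ - c′ * b′ ≈ 1R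
  det-resp ea eb ec ed = ≈-trans (≈-sym (+-cong (*-cong ea ed) (-‿cong (*-cong ec eb))))

  det-negate : a * d - c * b ≈ 1R → (- a) * (- d) - (- c) * (- b) ≈ 1R
  det-negate {a} {d} {c} {b} = ≈-trans (solve 4 (λ a b c d →
    (:- a) :* (:- d) :- (:- c) :* (:- b) := a :* d :- c :* b) ≈-refl a b c d)

  det-adjugate : a * d - c * b ≈ 1R → d * a - (- c) * (- b) ≈ 1R
  det-adjugate {a} {d} {c} {b} = ≈-trans (solve 4 (λ a b c d →
    d :* a :- (:- c) :* (:- b) := a :* d :- c :* b) ≈-refl a b c d)

  det-T : ∀ θ → 1R * 1R - 0R * θ ≈ 1R
  det-T = solve 1 (λ θ → con 1ℚ :* con 1ℚ :- con 0ℚ :* θ := con 1ℚ) ≈-refl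

  det-S : 0R * 0R - 1R * (- 1R) ≈ 1R
  det-S = solve 0 (con 0ℚ :* con 0ℚ :- con 1ℚ :* (:- con 1ℚ) := con 1ℚ) ≈-refl

  module Rows (θ : Carrier) where

    T₁ : ∀ a b → a * 1R + b * 0R ≈ a
    T₁ = solve 2 (λ a b → a :* con 1ℚ :+ b :* con 0ℚ := a) ≈-refl

    T₂ : ∀ a b → a * θ + b * 1R ≈ b + θ * a
    T₂ a b = solve 3 (λ a b θ → a :* θ :+ b :* con 1ℚ := b :+ θ :* a) ≈-refl a b θ

    T⁻¹₁ : ∀ a b → a * 1R + b * (- 0R) ≈ a
    T⁻¹₁ = solve 2 (λ a b → a :* con 1ℚ :+ b :* (:- con 0ℚ) := a) ≈-refl

    T⁻¹₂ : ∀ a b → a * (- θ) + b * 1R ≈ b - θ * a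
    T⁻¹₂ a b = solve 3 (λ a b θ → a :* (:- θ) :+ b :* con 1ℚ := b :- θ :* a) ≈-refl a b θ

    S₁ : ∀ a b → a * 0R + b * 1R ≈ b
    S₁ = solve 2 (λ a b → a :* con 0ℚ :+ b :* con 1ℚ := b) ≈-refl

    S₂ : ∀ a b → a * (- 1R) + b * 0R ≈ - a
    S₂ = solve 2 (λ a b → a :* (:- con 1ℚ) :+ b :* con 0ℚ := :- a) ≈-refl

    negate₁ : ∀ a b → b - θ * a ≈ - (θ * a - b)
    negate₁ a b = solve 3 (λ a b θ → b :- θ :* a := :- (θ :* a :- b)) ≈-refl a b θ

    unturn₂ : ∀ a b → - a + θ * b ≈ θ * b - a
    unturn₂ a b = solve 3 (λ a b θ → :- a :+ θ :* b := θ :* b :- a) ≈-refl a b θ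

  -- Integers in the ring, and the classes ℤ and ℤ√2.

  ⟦_⟧ : ℤ → Carrier
  ⟦ n ⟧ = ⌜ fromℤ n ⌝

  private
    ≡⇒≈ : ∀ {x y} → x ≡ y → x ≈ y
    ≡⇒≈ refl = ≈-refl

  open _-Raw-AlmostCommutative⟶_ constants using (+-homo; *-homo; -‿homo)

  ⟦⟧-homo-+ : ∀ m n → ⟦ m ℤ.+ n ⟧ ≈ ⟦ m ⟧ + ⟦ n ⟧
  ⟦⟧-homo-+ m n = ≈-trans (≡⇒≈ (cong ⌜_⌝ (fromℤ-homo-+ m n))) (+-homo (fromℤ m) (fromℤ n))

  ⟦⟧-homo-* : ∀ m n → ⟦ m ℤ.* n ⟧ ≈ ⟦ m ⟧ * ⟦ n ⟧
  ⟦⟧-homo-* m n = ≈-trans (≡⇒≈ (cong ⌜_⌝ (fromℤ-homo-* m n))) (*-homo (fromℤ m) (fromℤ n))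

  ⟦⟧-homo‿- : ∀ n → ⟦ ℤ.- n ⟧ ≈ - ⟦ n ⟧
  ⟦⟧-homo‿- n = ≈-trans (≡⇒≈ (cong ⌜_⌝ (fromℤ-homo‿- n))) (-‿homo (fromℤ n))

  ⟦⟧-mono-< : ∀ {m n} → m ℤ.< n → ⟦ m ⟧ < ⟦ n ⟧
  ⟦⟧-mono-< m<n = ⌜⌝-mono-< (fromℤ-mono-< m<n)

  ⟦⟧-mono-≤ : ∀ {m n} → m ℤ.≤ n → ⟦ m ⟧ ≤ ⟦ n ⟧
  ⟦⟧-mono-≤ {m} {n} m≤n with ℤₚ.<-cmp m n
  ... | tri< m<n _ _ = <⇒≤ (⟦⟧-mono-< m<n)
  ... | tri≈ _ refl _ = <-irrefl
  ... | tri> _ _ n<m = ⊥-elim (ℤₚ.<⇒≱ n<m m≤n)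

  module Parity {θ : Carrier} (θ>0 : 0R < θ) (θ²≈2 : θ * θ ≈ 2R) where

    root : Bool → Carrier
    root false = 1R
    root true  = θ

    1≤root : ∀ σ → 1R ≤ root σ
    1≤root false = <-irrefl
    1≤root true  = <⇒≤ (1<√2 θ>0 θ²≈2)

    root>0 : ∀ σ → 0R < root σ
    root>0 σ = <-≤-trans 0<1 (1≤root σ)

    -- ℤ for σ = false and ℤ√2 for σ = true.
    _∈ℤ√2^_ : Carrier → Bool → Set
    x ∈ℤ√2^ σ = ∃[ n ] x ≈ ⟦ n ⟧ * root σ

    ∈-resp : ∀ {σ} → x ≈ y → x ∈ℤ√2^ σ → y ∈ℤ√2^ σ
    ∈-resp x≈y (n , e) = n , ≈-trans (≈-sym x≈y) e

    ∈-+ : ∀ {σ} → x ∈ℤ√2^ σ → y ∈ℤ√2^ σ → (x + y) ∈ℤ√2^ σ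
    ∈-+ {x} {y} {σ} (m , e) (n , f) = m ℤ.+ n ,
      modulo e (- 1R) (modulo f (- 1R) (modulo (⟦⟧-homo-+ m n) (root σ) (solve 6 (λ x y m n k ω →
        x :+ y :+ (x :- m :* ω) :* (:- con 1ℚ) :+ (y :- n :* ω) :* (:- con 1ℚ) :+ (k :- (m :+ n)) :* ω
          := k :* ω) ≈-refl x y ⟦ m ⟧ ⟦ n ⟧ ⟦ m ℤ.+ n ⟧ (root σ))))

    ∈-neg : ∀ {σ} → x ∈ℤ√2^ σ → (- x) ∈ℤ√2^ σ
    ∈-neg {x} {σ} (n , e) = ℤ.- n ,
      modulo e 1R (modulo (⟦⟧-homo‿- n) (root σ) (solve 4 (λ x n k ω →
        :- x :+ (x :- n :* ω) :* con 1ℚ :+ (k :- :- n) :* ω := k :* ω)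
        ≈-refl x ⟦ n ⟧ ⟦ ℤ.- n ⟧ (root σ)))

    root-* : ∀ σ τ → (root σ * root τ) ∈ℤ√2^ (σ xor τ)
    root-* false τ     = ℤ.+ 1 , ≈-refl
    root-* true  false = ℤ.+ 1 , solve 1 (λ θ → θ :* con 1ℚ := con 1ℚ :* θ) ≈-refl θ
    root-* true  true  = ℤ.+ 2 , ≈-trans θ²≈2 (solve 0 (con (1ℚ ℚ.+ 1ℚ) := con (1ℚ ℚ.+ 1ℚ) :* con 1ℚ) ≈-refl)

    ∈-* : ∀ {σ τ} → x ∈ℤ√2^ σ → y ∈ℤ√2^ τ → (x * y) ∈ℤ√2^ (σ xor τ)
    ∈-* {x} {y} {σ} {τ} (m , e) (n , f) with root-* σ τ
    ... | k , g = m ℤ.* n ℤ.* k , ≈-trans (*-cong e f)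
      (≈-trans (solve 4 (λ m n ω χ → (m :* ω) :* (n :* χ) := (m :* n) :* (ω :* χ)) ≈-refl
          ⟦ m ⟧ ⟦ n ⟧ (root σ) (root τ))
        (≈-trans (*-cong (≈-sym (⟦⟧-homo-* m n)) g)
          (≈-trans (≈-sym (*-assoc _ _ _)) (*-congʳ (≈-sym (⟦⟧-homo-* (m ℤ.* n) k))))))

    private
      0-multiple : ∀ σ → x ≈ ⟦ ℤ.+ 0 ⟧ * root σ → x ≈ 0R
      0-multiple σ e = ≈-trans e (solve 1 (λ ω → con 0ℚ :* ω := con 0ℚ) ≈-refl (root σ))

      pos-multiple : ∀ {σ k} → x ≈ ⟦ ℤ.+ suc k ⟧ * root σ → 1R ≤ x
      pos-multiple {x} {σ} {k} e = 0≤diff⇒≤ (≤-respʳ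
        (modulo e 1R (solve 3 (λ x n ω →
          (n :- con 1ℚ) :* ω :+ (ω :- con 1ℚ) :+ (x :- n :* ω) :* con 1ℚ := x :- con 1ℚ)
          ≈-refl x ⟦ ℤ.+ suc k ⟧ (root σ)))
        (+-nonNeg (*-nonNeg (≤⇒0≤diff (⟦⟧-mono-≤ (ℤ.+≤+ (ℕ.s≤s ℕ.z≤n)))) (<⇒≤ (root>0 σ)))
          (≤⇒0≤diff (1≤root σ))))

    -- The sign of the integer coefficient decides; a nonzero one has absolute value at least 1, and
    -- so has the root. Applied to determinants, this is the gap that part (ii) rests on.
    zero-or-≥1 : ∀ {σ} → x ∈ℤ√2^ σ → (x ≈ 0R) ⊎ ((1R ≤ x) ⊎ (1R ≤ (- x)))
    zero-or-≥1 {σ = σ} (ℤ.+ zero , e) = inj₁ (0-multiple σ e)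
    zero-or-≥1 {σ = σ} (ℤ.+ suc k , e) = inj₂ (inj₁ (pos-multiple {σ = σ} {k} e))
    zero-or-≥1 {σ = σ} x∈@(ℤ.-[1+ k ] , e) =
      inj₂ (inj₂ (pos-multiple {σ = σ} {k} (proj₂ (∈-neg {σ = σ} x∈))))

    private
      integer-≤ : ∀ {m n} → x ≈ ⟦ m ⟧ * 1R → y ≈ ⟦ n ⟧ * 1R → m ℤ.≤ n → x ≤ y
      integer-≤ e f m≤n = ≤-respˡ (≈-sym (≈-trans e (*-identity _)))
        (≤-respʳ (≈-sym (≈-trans f (*-identity _))) (⟦⟧-mono-≤ m≤n))
        where
        *-identity : ∀ z → z * 1R ≈ z
        *-identity = solve 1 (λ z → z :* con 1ℚ := z) ≈-refl

    -- The squares are integers whatever the classes of x and y, their order is decidable, and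
    -- squaring reflects `≤` between nonnegative elements. This is what allows the split into s ≤ q
    -- and q ≤ s.
    compare : ∀ {σ τ} → x ∈ℤ√2^ σ → y ∈ℤ√2^ τ → 0R ≤ x → 0R ≤ y → (x ≤ y) ⊎ (y ≤ x)
    compare {x} {y} {σ} {τ} x∈ y∈ x≥0 y≥0 = by-squares
      (subst ((x * x) ∈ℤ√2^_) (Boolₚ.xor-same σ) (∈-* {σ = σ} {σ} x∈ x∈))
      (subst ((y * y) ∈ℤ√2^_) (Boolₚ.xor-same τ) (∈-* {σ = τ} {τ} y∈ y∈))
      where
      by-squares : (x * x) ∈ℤ√2^ false → (y * y) ∈ℤ√2^ false → (x ≤ y) ⊎ (y ≤ x)
      by-squares (m , e) (n , f) = Sum.map
        (λ m≤n → square-reflects-≤ x≥0 y≥0 (integer-≤ {m = m} {n} e f m≤n))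
        (λ n≤m → square-reflects-≤ y≥0 x≥0 (integer-≤ {m = n} {m} f e n≤m))
        (ℤₚ.≤-total m n)

    -- The zero case is kept apart because a column with s = 0 is the point at infinity and cannot
    -- be tested against a best approximation.
    Reduced : Carrier → Carrier → Set
    Reduced m s = ((s ≈ 0R) ⊎ (0R < s)) × (s < m)

    -- Both elements are integer multiples of the same root, so division with remainder takes place
    -- among the integer coefficients. No floor of a real number is ever taken.
    reduce : ∀ {σ m} → s ∈ℤ√2^ σ → m ∈ℤ√2^ σ → 0R < m → ∃[ k ] Reduced m (s - ⟦ k ⟧ * m)
    reduce {σ = σ} _ (ℤ.+ zero , f) m>0 = ⊥-elim (<-irrefl (<-respʳ (0-multiple σ f) m>0))
    reduce {σ = σ} {m} _ m∈@(ℤ.-[1+ c ] , f) m>0 =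
      ⊥-elim (<-irrefl (<-respʳ (solve 1 (λ m → m :+ :- m := con 0ℚ) ≈-refl m)
        (+-pos m>0 (<-≤-trans 0<1 (pos-multiple {σ = σ} {c} (proj₂ (∈-neg {σ = σ} m∈)))))))
    reduce {s} {σ} {m} (d , e) (ℤ.+ suc c , f) m>0 =
      k , sign ρ s′≈ , 0<diff⇒< (<-respʳ
        (modulo s′≈ (- 1R) (modulo f 1R (solve 5 (λ s′ ρ m c ω →
          (c :- ρ) :* ω :+ (s′ :- ρ :* ω) :* (:- con 1ℚ) :+ (m :- c :* ω) :* con 1ℚ := m :- s′)
          ≈-refl s′ ⟦ ℤ.+ ρ ⟧ m ⟦ ℤ.+ suc c ⟧ (root σ))))
        (*-pos (<⇒0<diff (⟦⟧-mono-< (ℤ.+<+ (ℤ.n%ℕd<d d (suc c))))) (root>0 σ)))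
      where
      ρ : ℕ
      ρ = d ℤ.%ℕ suc c
      k : ℤ
      k = d ℤ./ℕ suc c
      s′ : Carrier
      s′ = s - ⟦ k ⟧ * m
      d≈ : ⟦ d ⟧ ≈ ⟦ ℤ.+ ρ ⟧ + ⟦ k ⟧ * ⟦ ℤ.+ suc c ⟧
      d≈ = ≈-trans (≡⇒≈ (cong ⟦_⟧ (ℤ.a≡a%ℕn+[a/ℕn]*n d (suc c))))
        (≈-trans (⟦⟧-homo-+ (ℤ.+ ρ) (k ℤ.* ℤ.+ suc c)) (+-congˡ (⟦⟧-homo-* k (ℤ.+ suc c))))
      s′≈ : s′ ≈ ⟦ ℤ.+ ρ ⟧ * root σ
      s′≈ = modulo e (- 1R) (modulo f ⟦ k ⟧ (modulo d≈ (- root σ) (solve 7 (λ s m d ρ k c ω →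
        (s :- k :* m) :+ (s :- d :* ω) :* (:- con 1ℚ) :+ (m :- c :* ω) :* k
          :+ (d :- (ρ :+ k :* c)) :* (:- ω) := ρ :* ω)
        ≈-refl s m ⟦ d ⟧ ⟦ ℤ.+ ρ ⟧ ⟦ k ⟧ ⟦ ℤ.+ suc c ⟧ (root σ))))
      sign : ∀ r → x ≈ ⟦ ℤ.+ r ⟧ * root σ → (x ≈ 0R) ⊎ (0R < x)
      sign zero    g = inj₁ (0-multiple σ g)
      sign (suc r) g = inj₂ (<-≤-trans 0<1 (pos-multiple {σ = σ} {r} g))

    -- The two shapes of a matrix of H₄: integers on one diagonal and multiples of √2 on the other.
    -- T has the shape `false`, S the shape `true`, and shapes add modulo 2 under multiplication.
    Entries : Bool → (a b c d : Carrier) → Set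
    Entries σ a b c d = a ∈ℤ√2^ σ × b ∈ℤ√2^ not σ × c ∈ℤ√2^ not σ × d ∈ℤ√2^ σ

    0∈ : ∀ σ → 0R ∈ℤ√2^ σ
    0∈ σ = ℤ.+ 0 , solve 1 (λ ω → con 0ℚ := con 0ℚ :* ω) ≈-refl (root σ)

    root∈ : ∀ σ → root σ ∈ℤ√2^ σ
    root∈ σ = ℤ.+ 1 , solve 1 (λ ω → ω := con 1ℚ :* ω) ≈-refl (root σ)

    entries-T : Entries false 1R θ 0R 1R
    entries-T = root∈ false , root∈ true , 0∈ true , root∈ false

    entries-S : Entries true 0R (- 1R) 1R 0R
    entries-S = 0∈ true , ∈-neg {σ = false} (root∈ false) , root∈ false , 0∈ true

    entries-1 : Entries false 1R 0R 0R 1R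
    entries-1 = root∈ false , 0∈ true , 0∈ true , root∈ false

    entries-adjugate : ∀ σ → Entries σ a b c d → Entries σ d (- b) (- c) a
    entries-adjugate σ (a∈ , b∈ , c∈ , d∈) = d∈ , ∈-neg {σ = not σ} b∈ , ∈-neg {σ = not σ} c∈ , a∈

    entries-negate : ∀ σ → Entries σ a b c d → Entries σ (- a) (- b) (- c) (- d)
    entries-negate σ (a∈ , b∈ , c∈ , d∈) =
      ∈-neg {σ = σ} a∈ , ∈-neg {σ = not σ} b∈ , ∈-neg {σ = not σ} c∈ , ∈-neg {σ = σ} d∈

    entries-resp : ∀ {a b c d a′ b′ c′ d′} σ → a ≈ a′ → b ≈ b′ → c ≈ c′ → d ≈ d′ →
      Entries σ a b c d → Entries σ a′ b′ c′ d′
    entries-resp σ ea eb ec ed (a∈ , b∈ , c∈ , d∈) =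
      ∈-resp {σ = σ} ea a∈ , ∈-resp {σ = not σ} eb b∈ , ∈-resp {σ = not σ} ec c∈ , ∈-resp {σ = σ} ed d∈

    entries-product : ∀ {a b c d a′ b′ c′ d′} σ τ → Entries σ a b c d → Entries τ a′ b′ c′ d′ →
      Entries (σ xor τ) (a * a′ + b * c′) (a * b′ + b * d′) (c * a′ + d * c′) (c * b′ + d * d′)
    entries-product σ τ (a∈ , b∈ , c∈ , d∈) (a′∈ , b′∈ , c′∈ , d′∈) =
        ∈-+ {σ = σ xor τ} (∈-* {σ = σ} {τ} a∈ a′∈) (annihilate (∈-* {σ = not σ} {not τ} b∈ c′∈))
      , ∈-+ {σ = not (σ xor τ)} (outʳ (∈-* {σ = σ} {not τ} a∈ b′∈)) (outˡ (∈-* {σ = not σ} {τ} b∈ d′∈))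
      , ∈-+ {σ = not (σ xor τ)} (outˡ (∈-* {σ = not σ} {τ} c∈ a′∈)) (outʳ (∈-* {σ = σ} {not τ} d∈ c′∈))
      , ∈-+ {σ = σ xor τ} (annihilate (∈-* {σ = not σ} {not τ} c∈ b′∈)) (∈-* {σ = σ} {τ} d∈ d′∈)
      where
      annihilate : x ∈ℤ√2^ (not σ xor not τ) → x ∈ℤ√2^ (σ xor τ)
      annihilate {x} = subst (x ∈ℤ√2^_) (Boolₚ.xor-annihilates-not σ τ)
      outˡ : x ∈ℤ√2^ (not σ xor τ) → x ∈ℤ√2^ not (σ xor τ)
      outˡ {x} = subst (x ∈ℤ√2^_) (sym (Boolₚ.not-distribˡ-xor σ τ))
      outʳ : x ∈ℤ√2^ (σ xor not τ) → x ∈ℤ√2^ not (σ xor τ)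
      outʳ {x} = subst (x ∈ℤ√2^_) (sym (Boolₚ.not-distribʳ-xor σ τ))

    shift-0 : ∀ b m → b ≈ b - ⟦ ℤ.+ 0 ⟧ * m
    shift-0 = solve 2 (λ b m → b := b :- con 0ℚ :* m) ≈-refl

    shift-suc : ∀ n b m → (b - ⟦ ℤ.+ n ⟧ * m) - m ≈ b - ⟦ ℤ.+ suc n ⟧ * m
    shift-suc n b m = modulo (⟦⟧-homo-+ (ℤ.+ 1) (ℤ.+ n)) (- m) (solve 4 (λ b m n k →
      ((b :- n :* m) :- m) :+ (k :- (con 1ℚ :+ n)) :* (:- m) := b :- k :* m)
      ≈-refl b m ⟦ ℤ.+ n ⟧ ⟦ ℤ.+ suc n ⟧)

    shift--1 : ∀ b m → b + m ≈ b - ⟦ ℤ.-[1+ 0 ] ⟧ * m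
    shift--1 = solve 2 (λ b m → b :+ m := b :- con (fromℤ ℤ.-[1+ 0 ]) :* m) ≈-refl

    shift-pred : ∀ n b m → (b - ⟦ ℤ.-[1+ n ] ⟧ * m) + m ≈ b - ⟦ ℤ.-[1+ suc n ] ⟧ * m
    shift-pred n b m = modulo (⟦⟧-homo-+ ℤ.-[1+ 0 ] ℤ.-[1+ n ]) (- m) (solve 4 (λ b m n k →
      ((b :- n :* m) :+ m) :+ (k :- (con (fromℤ ℤ.-[1+ 0 ]) :+ n)) :* (:- m) := b :- k :* m)
      ≈-refl b m ⟦ ℤ.-[1+ n ] ⟧ ⟦ ℤ.-[1+ suc n ] ⟧)

    -- The group enters only through its closure rules, the determinant and the shape of the
    -- entries. The inductions over `H₄` that supply the last two come after the reals are known to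
    -- form an ordered ring.
    module HeckeGroup
      (H : (a b c d : Carrier) → Set)
      (H-T : H 1R θ 0R 1R) (H-S : H 0R (- 1R) 1R 0R) (H-1 : H 1R 0R 0R 1R)
      (H-product : ∀ {a b c d a′ b′ c′ d′} → H a b c d → H a′ b′ c′ d′ →
        H (a * a′ + b * c′) (a * b′ + b * d′) (c * a′ + d * c′) (c * b′ + d * d′))
      (H-inverse : ∀ {a b c d} → H a b c d → H d (- b) (- c) a)
      (H-resp : ∀ {a b c d a′ b′ c′ d′} → a ≈ a′ → b ≈ b′ → c ≈ c′ → d ≈ d′ →
        H a b c d → H a′ b′ c′ d′)
      (H-negate : ∀ {a b c d} → H (- a) (- b) (- c) (- d) → H a b c d)
      (det-H : ∀ {a b c d} → H a b c d → a * d - c * b ≈ 1R)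
      (entries-H : ∀ {a b c d} → H a b c d → ∃[ σ ] Entries σ a b c d) where

      -- Moves on the columns of a matrix of the group.

      open Rows θ

      ·T : H a b c d → H a (b + θ * a) c (d + θ * c)
      ·T M = H-resp (T₁ _ _) (T₂ _ _) (T₁ _ _) (T₂ _ _) (H-product M H-T)

      ·T⁻¹ : H a b c d → H a (b - θ * a) c (d - θ * c)
      ·T⁻¹ M = H-resp (T⁻¹₁ _ _) (T⁻¹₂ _ _) (T⁻¹₁ _ _) (T⁻¹₂ _ _) (H-product M (H-inverse H-T))

      ·S : H a b c d → H b (- a) d (- c)
      ·S M = H-resp (S₁ _ _) (S₂ _ _) (S₁ _ _) (S₂ _ _) (H-product M H-S)

      -- Right multiplication by T⁻¹S up to sign. This element has order 4 in PSL₂(ℝ), and it moves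
      -- the two columns to the next side of their quadrilateral of cusps; `unturn` moves them back.
      turn : H a b c d → H (θ * a - b) a (θ * c - d) c
      turn M = H-negate (H-resp (negate₁ _ _) ≈-refl (negate₁ _ _) ≈-refl (·S (·T⁻¹ M)))

      unturn : H a b c d → H b (θ * b - a) d (θ * d - c)
      unturn M = H-resp ≈-refl (unturn₂ _ _) ≈-refl (unturn₂ _ _) (·T (·S M))

      ·T^ : ∀ k → H a b c d → H a (b - ⟦ k ⟧ * (θ * a)) c (d - ⟦ k ⟧ * (θ * c))
      ·T^ (ℤ.+ zero) M = H-resp ≈-refl (shift-0 _ _) ≈-refl (shift-0 _ _) M
      ·T^ (ℤ.+ suc n) M = H-resp ≈-refl (shift-suc n _ _) ≈-refl (shift-suc n _ _) (·T⁻¹ (·T^ (ℤ.+ n) M))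
      ·T^ ℤ.-[1+ zero ] M = H-resp ≈-refl (shift--1 _ _) ≈-refl (shift--1 _ _) (·T M)
      ·T^ ℤ.-[1+ suc n ] M =
        H-resp ≈-refl (shift-pred n _ _) ≈-refl (shift-pred n _ _) (·T (·T^ ℤ.-[1+ n ] M))

      -- Distinctness of fractions is expressed by a determinant that does not vanish, which keeps
      -- inverses out of the argument.
      BestApproximation : (α p q : Carrier) → Set
      BestApproximation α p q = ∀ {r r′ s s′} → H r r′ s s′ → 0R < s → s ≤ q →
        ¬ (p * s - q * r ≈ 0R) → ∣ q * α - p ∣ < ∣ s * α - r ∣

      -- Best approximations are close.

      module _ {α p q : Carrier} (q>0 : 0R < q) (best : BestApproximation α p q) where

        private
          ξ : Carrier
          ξ = q * α - p

        lower-side : H p r q s → 0R < s → s ≤ θ * q → q * (- ξ) < 1R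
        lower-side {r} {s} M s>0 s≤θq =
          let σ , _ , _ , q∈ , s∈ = entries-H M
          in Sum.[ near , far ]′ (compare {σ = σ} {not σ} s∈ q∈ (<⇒≤ s>0) (<⇒≤ q>0))
          where
          near : s ≤ q → q * (- ξ) < 1R
          near s≤q = near-bound q>0 (x≤∣x∣ ξ) (-x≤∣x∣ ξ) (<⇒≤ s>0) s≤q
            (column-relation α (det-H M))
            (<∣∣ (best (·S M) s>0 s≤q (det-nonzero 0<1 (det-H M))))
          far : q ≤ s → q * (- ξ) < 1R
          far q≤s = far-bound q>0 (x≤∣x∣ ξ) (-x≤∣x∣ ξ) θ>0 θ²≈2 (<⇒≤ f>0) f≤q q≤s
            (column-relation α (far-det (det-H M)))
            -- Two moves bring √2(r , s) - (p , q), the cusp opposite to (p , q), into the first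
            -- column.
            (<∣∣ (best (unturn (unturn M)) f>0 f≤q (det-nonzero θ>0 (far-det (det-H M)))))
            where
            f>0 = far-pos θ>0 θ²≈2 q>0 q≤s
            f≤q = far-≤ θ>0 θ²≈2 s≤θq

        upper-side : H r p s q → 0R < s → s ≤ θ * q → q * ξ < 1R
        upper-side {r} {s} M s>0 s≤θq =
          let σ , _ , _ , s∈ , q∈ = entries-H M
          in <-respˡ (solve 2 (λ q X → q :* (:- :- X) := q :* X) ≈-refl q ξ)
            (Sum.[ near , far ]′ (compare {σ = not σ} {σ} s∈ q∈ (<⇒≤ s>0) (<⇒≤ q>0)))
          where
          near : s ≤ q → q * (- - ξ) < 1R
          near s≤q = near-bound q>0 (-x≤∣x∣ ξ) (≤-neg-neg (x≤∣x∣ ξ)) (<⇒≤ s>0) s≤q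
            (column-relation⁻ α (det-H M))
            (<∣∣-negate (<∣∣ (best M s>0 s≤q (det-nonzero⁻ 0<1 (det-H M)))))
          far : q ≤ s → q * (- - ξ) < 1R
          far q≤s = far-bound q>0 (-x≤∣x∣ ξ) (≤-neg-neg (x≤∣x∣ ξ)) θ>0 θ²≈2 (<⇒≤ f>0) f≤q q≤s
            (column-relation⁻ α (far-det⁻ (det-H M)))
            (<∣∣-negate (<∣∣ (best (turn M) f>0 f≤q (det-nonzero⁻ θ>0 (far-det⁻ (det-H M))))))
            where
            f>0 = far-pos θ>0 θ²≈2 q>0 q≤s
            f≤q = far-≤ θ>0 θ²≈2 s≤θq

        -- (r , s) and √2(p , q) - (r , s) are the neighbours of p/q on its two sides, and their
        -- denominators add up to √2q. So for 0 < s < √2q both lie in the range that the two side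
        -- lemmas accept.
        reduced-best-is-close : H p r q s → Reduced (θ * q) s → q * ξ < 1R × q * (- ξ) < 1R
        reduced-best-is-close {r} {s} M (s-sign , s<θq) =
            upper-side (turn M) (<⇒0<diff s<θq) (0≤diff⇒≤ (≤-respʳ
              (solve 2 (λ s m → s := m :- (m :- s)) ≈-refl s (θ * q)) (s≥0 s-sign)))
          , lower s-sign
          where
          s≥0 : (s ≈ 0R) ⊎ (0R < s) → 0R ≤ s
          s≥0 (inj₁ s≈0) = ≤-respʳ (≈-sym s≈0) <-irrefl
          s≥0 (inj₂ s>0) = <⇒≤ s>0
          lower : (s ≈ 0R) ⊎ (0R < s) → q * (- ξ) < 1R
          lower (inj₂ s>0) = lower-side M s>0 (<⇒≤ s<θq)
          -- Here the neighbour is the point at infinity. Adding √2(p , q) to it gives the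
          -- denominator √2q, the end point that `lower-side` still allows.
          lower (inj₁ s≈0) = lower-side (·T M) (<-respʳ (≈-sym s+m≈m) (*-pos θ>0 q>0))
            (≤-respˡ (≈-sym s+m≈m) <-irrefl)
            where
            s+m≈m : s + θ * q ≈ θ * q
            s+m≈m = ≈-trans (+-congʳ s≈0) (solve 1 (λ m → con 0ℚ :+ m := m) ≈-refl (θ * q))

        best-is-close : H p r q s → q * ξ < 1R × q * (- ξ) < 1R
        best-is-close {r} {s} M =
          let σ , _ , _ , q∈ , s∈ = entries-H M
              -- q lies in the class opposite to that of s; the factor √2 moves it into the class of
              -- s, as `reduce` requires.
              θq∈ = subst ((θ * q) ∈ℤ√2^_) (Boolₚ.not-involutive σ) (∈-* {σ = true} {not σ} (root∈ true) q∈)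
              k , reduced = reduce {σ = σ} s∈ θq∈ (*-pos θ>0 q>0)
          in reduced-best-is-close (·T^ k M) reduced

      -- ps - qr is the lower left entry of M⁻¹N. Hence it is an integer or √2 times an integer
      -- simply because M⁻¹N belongs to the group.
      close-best : ∀ {α p q r s} → 0R < q → H p r q s → q * ∣ q * α - p ∣ < ½R → BestApproximation α p q
      close-best {p = p} {q} q>0 M h {r} {r′} {s} {s′} N s>0 s≤q det≢0 =
        let σ , _ , _ , D∈ , _ = entries-H (H-product (H-inverse M) N)
        in close-is-best q>0 (<⇒≤ s>0) s≤q h (nonzero (zero-or-≥1 {σ = not σ} D∈))
        where
        nonzero : ((- q) * r + p * s ≈ 0R) ⊎ ((1R ≤ (- q) * r + p * s) ⊎ (1R ≤ - ((- q) * r + p * s))) →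
          (1R ≤ p * s - q * r) ⊎ (1R ≤ - (p * s - q * r))
        nonzero (inj₁ D≈0) = ⊥-elim (det≢0 (≈-trans
          (solve 4 (λ p q r s → p :* s :- q :* r := (:- q) :* r :+ p :* s) ≈-refl p q r s) D≈0))
        nonzero (inj₂ D≥1) = Sum.map
          (≤-respʳ (solve 4 (λ p q r s → (:- q) :* r :+ p :* s := p :* s :- q :* r) ≈-refl p q r s))
          (≤-respʳ (solve 4 (λ p q r s → :- ((:- q) :* r :+ p :* s) := :- (p :* s :- q :* r)) ≈-refl p q r s))
          D≥1

      -- Pell matrices in the group.

      1≤⟦suc⟧ : ∀ n → 1R ≤ ⟦ ℤ.+ suc n ⟧
      1≤⟦suc⟧ n = ⟦⟧-mono-≤ (ℤ.+≤+ (ℕ.s≤s ℕ.z≤n))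

      -- The index is only a lower bound for δ: growth by at least 1 at each step is enough. The
      -- offset makes the identity matrix, with δ = 1 and κ = 0, the case n = 0.
      record PellMatrix (n : ℕ) : Set where
        field
          {δ κ} : Carrier
          matrix : H δ κ κ δ
          κ≥0   : 0R ≤ κ
          n<δ   : ⟦ ℤ.+ suc n ⟧ ≤ δ

        1≤δ : 1R ≤ δ
        1≤δ = ≤-trans (1≤⟦suc⟧ n) n<δ

      open PellStep θ²≈2

      -- With b = √2j this multiplies a + j√2 by 3 + 2√2, the fundamental solution of x² - 2y² = 1.
      pell-step : H a b b a → H (⌜ 3ℚ ⌝ * a + 2R * θ * b) (⌜ 3ℚ ⌝ * b + 2R * θ * a)
        (⌜ 3ℚ ⌝ * b + 2R * θ * a) (⌜ 3ℚ ⌝ * a + 2R * θ * b)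
      pell-step M = H-resp (stepˡ _ _) (stepʳ _ _) (stepˡ _ _) (stepʳ _ _) (·T (·S (·T (·T (·S (·T M))))))

      pell-matrix : ∀ n → PellMatrix n
      pell-matrix zero = record { matrix = H-1 ; κ≥0 = <-irrefl ; n<δ = <-irrefl }
      pell-matrix (suc n) = record
        { matrix = pell-step matrix
        ; κ≥0 = <⇒≤ (step-k>0 θ>0 1≤δ κ≥0)
        ; n<δ = ≤-respˡ (≈-sym (⟦⟧-homo-+ (ℤ.+ 1) (ℤ.+ suc n))) (step-d θ>0 1≤δ κ≥0 n<δ) }
        where open PellMatrix (pell-matrix n)

      close-pair : ∀ n {ε} → 0R < ε → 1R ≤ ⟦ ℤ.+ n ⟧ * ε → 1R ≤ ⟦ ℤ.+ n ⟧ →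
        ∃[ d ] ∃[ k ] H d k k d × 0R < d × 0R < k × d * (d - k) < ½R + ε
      -- One step beyond `pell-matrix n`, because κ may be 0 there, while k has to be positive to
      -- serve as the denominator of d/k.
      close-pair n ε>0 1≤nε 1≤n = _ , _ , pell-step matrix , d′>0 , k′>0 ,
        Pell.gap-small d′>0 k′>0 (det-H (pell-step matrix)) ε>0 1≤n n≤d′ 1≤nε
        where
        open PellMatrix (pell-matrix n)
        n≤d′ : ⟦ ℤ.+ n ⟧ ≤ ⌜ 3ℚ ⌝ * δ + 2R * θ * κ
        n≤d′ = ≤-trans (⟦⟧-mono-≤ (ℤ.+≤+ (ℕₚ.n≤1+n n)))
          (≤-trans n<δ (≤-trans (0≤diff⇒≤ (≤-respʳ (solve 1 (λ d → con 1ℚ := con 1ℚ :+ d :- d) ≈-refl δ) 0≤1))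
            (step-d θ>0 1≤δ κ≥0 <-irrefl)))
        k′>0 : 0R < ⌜ 3ℚ ⌝ * κ + 2R * θ * δ
        k′>0 = step-k>0 θ>0 1≤δ κ≥0
        d′>0 : 0R < ⌜ 3ℚ ⌝ * δ + 2R * θ * κ
        d′>0 = <-≤-trans 0<1 (≤-trans 1≤n n≤d′)

-- The real numbers

open import Defs

Eventually : (ℕ → Set) → Set
Eventually P = ∃[ N ] ∀ n → N ℕ.≤ n → P n

ev-map : ∀ {P Q : ℕ → Set} → (∀ n → P n → Q n) → Eventually P → Eventually Q
ev-map h (N , f) = N , λ n p → h n (f n p)

ev-map₂ : ∀ {P Q R : ℕ → Set} → (∀ n → P n → Q n → R n) →
  Eventually P → Eventually Q → Eventually R
ev-map₂ h (M , f) (N , g) = M ℕ.⊔ N , λ n p →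
  h n (f n (ℕₚ.m⊔n≤o⇒m≤o M N p)) (g n (ℕₚ.m⊔n≤o⇒n≤o M N p))

eventually-witness : ∀ {P : ℕ → Set} → Eventually P → ∃[ n ] P n
eventually-witness (N , f) = N , f N ℕₚ.≤-refl

module _ where
  open ℚSolver.+-*-Solver

  0<diff : ∀ {a b} → a ℚ.< b → 0ℚ ℚ.< b ℚ.- a
  0<diff {a} {b} h = subst (ℚ._< b ℚ.- a) (ℚₚ.+-inverseʳ a) (ℚₚ.+-monoˡ-< (ℚ.- a) h)

  0≤diff : ∀ {a b} → a ℚ.≤ b → 0ℚ ℚ.≤ b ℚ.- a
  0≤diff {a} {b} h = subst (ℚ._≤ b ℚ.- a) (ℚₚ.+-inverseʳ a) (ℚₚ.+-monoˡ-≤ (ℚ.- a) h)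

  -- Rational inequalities below are proved by writing b - a as a sum of terms known to be positive;
  -- the identity is left to the ring solver.
  <-by : ∀ {a b t} → 0ℚ ℚ.< t → t ≡ b ℚ.- a → a ℚ.< b
  <-by {a} {b} t>0 refl = subst₂ ℚ._<_ (ℚₚ.+-identityˡ a)
    (solve 2 (λ a b → b :- a :+ a := b) refl a b) (ℚₚ.+-monoˡ-< a t>0)

  ≤-by : ∀ {a b t} → 0ℚ ℚ.≤ t → t ≡ b ℚ.- a → a ℚ.≤ b
  ≤-by {a} {b} t≥0 refl = subst₂ ℚ._≤_ (ℚₚ.+-identityˡ a)
    (solve 2 (λ a b → b :- a :+ a := b) refl a b) (ℚₚ.+-monoˡ-≤ a t≥0)

  scale-pos : ∀ c {{_ : ℚ.Positive c}} {ε} → 0ℚ ℚ.< ε → 0ℚ ℚ.< c ℚ.* ε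
  scale-pos c {ε} ε>0 = subst (ℚ._< c ℚ.* ε) (ℚₚ.*-zeroʳ c) (ℚₚ.*-monoʳ-<-pos c ε>0)

  p≤∣p∣ : ∀ p → p ℚ.≤ ℚ.∣ p ∣
  p≤∣p∣ p with ℚₚ.≤-total 0ℚ p
  ... | inj₁ p≥0 = ℚₚ.≤-reflexive (sym (ℚₚ.0≤p⇒∣p∣≡p p≥0))
  ... | inj₂ p≤0 = ℚₚ.≤-trans p≤0 (ℚₚ.0≤∣p∣ p)

  -p≤∣p∣ : ∀ p → ℚ.- p ℚ.≤ ℚ.∣ p ∣
  -p≤∣p∣ p = subst (ℚ.- p ℚ.≤_) (ℚₚ.∣-p∣≡∣p∣ p) (p≤∣p∣ (ℚ.- p))

  ∣∣<-intro : ∀ {a b} → a ℚ.< b → ℚ.- a ℚ.< b → ℚ.∣ a ∣ ℚ.< b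
  ∣∣<-intro {a} p q with ℚₚ.∣p∣≡p∨∣p∣≡-p a
  ... | inj₁ e = subst (ℚ._< _) (sym e) p
  ... | inj₂ e = subst (ℚ._< _) (sym e) q

  above : ∀ a b {ε} → ℚ.∣ a ℚ.- b ∣ ℚ.< ε → 0ℚ ℚ.< ε ℚ.- (a ℚ.- b)
  above a b h = 0<diff (ℚₚ.≤-<-trans (p≤∣p∣ _) h)

  below : ∀ a b {ε} → ℚ.∣ a ℚ.- b ∣ ℚ.< ε → 0ℚ ℚ.< ε ℚ.- (b ℚ.- a)
  below a b {ε} h = subst (λ t → 0ℚ ℚ.< ε ℚ.- t) (solve 2 (λ a b → :- (a :- b) := b :- a) refl a b)
    (0<diff (ℚₚ.≤-<-trans (-p≤∣p∣ (a ℚ.- b)) h))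

  close : ∀ a b {ε} → 0ℚ ℚ.< ε ℚ.- (a ℚ.- b) → 0ℚ ℚ.< ε ℚ.- (b ℚ.- a) → ℚ.∣ a ℚ.- b ∣ ℚ.< ε
  close a b {ε} h h′ = ∣∣<-intro (<-by h refl)
    (<-by h′ (solve 3 (λ a b ε → ε :- (b :- a) := ε :- :- (a :- b)) refl a b ε))

  ¼ ⅛ : ℚ
  ¼ = ½ ℚ.* ½
  ⅛ = ½ ℚ.* ¼

  termwise : ∀ {x y} → (∀ n → seq x n ≡ seq y n) → x ≈ y
  termwise {x} {y} h ε ε>0 = 0 , λ n _ → subst (ℚ._< ε)
    (sym (cong ℚ.∣_∣ (trans (cong (ℚ._- seq y n) (h n)) (ℚₚ.+-inverseʳ (seq y n))))) ε>0

  ≈-sym : ∀ {x y} → x ≈ y → y ≈ x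
  ≈-sym {x} {y} h ε ε>0 = ev-map
    (λ n p → close (seq y n) (seq x n) (below (seq x n) (seq y n) p) (above (seq x n) (seq y n) p))
    (h ε ε>0)

  ≈-trans : ∀ {x y z} → x ≈ y → y ≈ z → x ≈ z
  ≈-trans {x} {y} {z} h h′ ε ε>0 = ev-map₂
    (λ n p q → let a = seq x n ; b = seq y n ; c = seq z n in close a c
      (subst (0ℚ ℚ.<_) (e a b c) (ℚₚ.+-mono-< (above a b p) (above b c q)))
      (subst (0ℚ ℚ.<_) (e′ a b c) (ℚₚ.+-mono-< (below a b p) (below b c q))))
    (h (½ ℚ.* ε) (scale-pos ½ ε>0)) (h′ (½ ℚ.* ε) (scale-pos ½ ε>0))
    where
    e : ∀ a b c → (½ ℚ.* ε ℚ.- (a ℚ.- b)) ℚ.+ (½ ℚ.* ε ℚ.- (b ℚ.- c)) ≡ ε ℚ.- (a ℚ.- c)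
    e a b c = solve 4 (λ a b c ε → (con ½ :* ε :- (a :- b)) :+ (con ½ :* ε :- (b :- c)) := ε :- (a :- c))
      refl a b c ε
    e′ : ∀ a b c → (½ ℚ.* ε ℚ.- (b ℚ.- a)) ℚ.+ (½ ℚ.* ε ℚ.- (c ℚ.- b)) ≡ ε ℚ.- (c ℚ.- a)
    e′ a b c = solve 4 (λ a b c ε → (con ½ :* ε :- (b :- a)) :+ (con ½ :* ε :- (c :- b)) := ε :- (c :- a))
      refl a b c ε

  +-cong : ∀ {x x′ y y′} → x ≈ x′ → y ≈ y′ → x + y ≈ x′ + y′
  +-cong {x} {x′} {y} {y′} h h′ ε ε>0 = ev-map₂
    (λ n p q → let a = seq x n ; b = seq x′ n ; c = seq y n ; d = seq y′ n in close (a ℚ.+ c) (b ℚ.+ d)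
      (subst (0ℚ ℚ.<_) (e a b c d) (ℚₚ.+-mono-< (above a b p) (above c d q)))
      (subst (0ℚ ℚ.<_) (e b a d c) (ℚₚ.+-mono-< (below a b p) (below c d q))))
    (h (½ ℚ.* ε) (scale-pos ½ ε>0)) (h′ (½ ℚ.* ε) (scale-pos ½ ε>0))
    where
    e : ∀ a b c d → (½ ℚ.* ε ℚ.- (a ℚ.- b)) ℚ.+ (½ ℚ.* ε ℚ.- (c ℚ.- d)) ≡ ε ℚ.- ((a ℚ.+ c) ℚ.- (b ℚ.+ d))
    e a b c d = solve 5 (λ a b c d ε →
      (con ½ :* ε :- (a :- b)) :+ (con ½ :* ε :- (c :- d)) := ε :- ((a :+ c) :- (b :+ d)))
      refl a b c d ε

  -‿cong : ∀ {x y} → x ≈ y → - x ≈ - y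
  -‿cong {x} {y} h ε ε>0 = ev-map
    (λ n p → subst (ℚ._< ε) (trans (sym (ℚₚ.∣-p∣≡∣p∣ (seq x n ℚ.- seq y n)))
      (cong ℚ.∣_∣ (solve 2 (λ a b → :- (a :- b) := :- a :- :- b) refl (seq x n) (seq y n))))
      p)
    (h ε ε>0)

  bounded : ∀ x → ∃[ B ] 0ℚ ℚ.< B × Eventually (λ n → ℚ.∣ seq x n ∣ ℚ.≤ B)
  bounded x with cauchy x 1ℚ (ℚₚ.positive⁻¹ 1ℚ)
  ... | N , f = 1ℚ ℚ.+ ℚ.∣ seq x N ∣
    , ℚₚ.+-mono-<-≤ (ℚₚ.positive⁻¹ 1ℚ) (ℚₚ.0≤∣p∣ (seq x N))
    , N , λ n p → ℚₚ.≤-trans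
        (subst (λ z → ℚ.∣ z ∣ ℚ.≤ ℚ.∣ seq x n ℚ.- seq x N ∣ ℚ.+ ℚ.∣ seq x N ∣)
          (solve 2 (λ a b → (a :- b) :+ b := a) refl (seq x n) (seq x N))
          (ℚₚ.∣p+q∣≤∣p∣+∣q∣ (seq x n ℚ.- seq x N) (seq x N)))
        (ℚₚ.+-monoˡ-≤ ℚ.∣ seq x N ∣ (ℚₚ.<⇒≤ (f n N p ℕₚ.≤-refl)))

  quotient : ∀ {B ε} → 0ℚ ℚ.< B → 0ℚ ℚ.< ε → ∃[ δ ] 0ℚ ℚ.< δ × B ℚ.* δ ≡ ε
  quotient {B} {ε} B>0 ε>0 = ℚ.1/ B ℚ.* ε
    , scale-pos (ℚ.1/ B) {{ℚₚ.1/pos⇒pos B}} ε>0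
    , trans (sym (ℚₚ.*-assoc B (ℚ.1/ B) ε))
        (trans (cong (ℚ._* ε) (ℚₚ.*-inverseʳ B)) (ℚₚ.*-identityˡ ε))
    where
    instance
      B-pos : ℚ.Positive B
      B-pos = ℚ.positive B>0
      B-nonZero : ℚ.NonZero B
      B-nonZero = ℚₚ.pos⇒nonZero B

  mul-close : ∀ {a b c B δ} → 0ℚ ℚ.< B → ℚ.∣ a ∣ ℚ.≤ B → ℚ.∣ b ℚ.- c ∣ ℚ.< δ →
    ℚ.∣ a ℚ.* b ℚ.- a ℚ.* c ∣ ℚ.< B ℚ.* δ
  mul-close {a} {b} {c} {B} {δ} B>0 p q = subst (λ t → ℚ.∣ t ∣ ℚ.< B ℚ.* δ)
    (solve 3 (λ a b c → a :* (b :- c) := a :* b :- a :* c) refl a b c)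
    (subst (ℚ._< B ℚ.* δ) (sym (ℚₚ.∣p*q∣≡∣p∣*∣q∣ a (b ℚ.- c)))
      (ℚₚ.≤-<-trans (ℚₚ.*-monoʳ-≤-nonNeg ℚ.∣ b ℚ.- c ∣ {{ℚₚ.∣-∣-nonNeg (b ℚ.- c)}} p)
        (ℚₚ.*-monoʳ-<-pos B {{ℚ.positive B>0}} q)))

  *-congˡ : ∀ x {y y′} → y ≈ y′ → x * y ≈ x * y′
  *-congˡ x {y} {y′} h ε ε>0 =
    let B , B>0 , b = bounded x
        δ , δ>0 , e = quotient B>0 ε>0
    in ev-map₂ (λ n p q → subst (ℚ.∣ seq x n ℚ.* seq y n ℚ.- seq x n ℚ.* seq y′ n ∣ ℚ.<_) e
         (mul-close {seq x n} {seq y n} {seq y′ n} {B} {δ} B>0 p q))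
       b (h δ δ>0)

  *-comm : ∀ x y → x * y ≈ y * x
  *-comm x y = termwise {x * y} {y * x} (λ n → ℚₚ.*-comm (seq x n) (seq y n))

  *-cong : ∀ {x x′ y y′} → x ≈ x′ → y ≈ y′ → x * y ≈ x′ * y′
  *-cong {x} {x′} {y} {y′} h h′ = ≈-trans {x * y} {x * y′} {x′ * y′} (*-congˡ x {y} {y′} h′)
    (≈-trans {x * y′} {y′ * x} {x′ * y′} (*-comm x y′)
      (≈-trans {y′ * x} {y′ * x′} {x′ * y′} (*-congˡ y′ {x} {x′} h) (*-comm y′ x′)))

  ℝ-commutativeRing : CommutativeRing 0ℓ 0ℓ
  ℝ-commutativeRing = record
    { Carrier = ℝ ; _≈_ = _≈_ ; _+_ = _+_ ; _*_ = _*_ ; -_ = -_ ; 0# = 0ℝ ; 1# = 1ℝ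
    ; isCommutativeRing = record
      { isRing = record
        { +-isAbelianGroup = record
          { isGroup = record
            { isMonoid = record
              { isSemigroup = record
                { isMagma = record
                  { isEquivalence = record
                    { refl = λ {x} → termwise {x} {x} (λ _ → refl)
                    ; sym = λ {x} {y} → ≈-sym {x} {y}
                    ; trans = λ {x} {y} {z} → ≈-trans {x} {y} {z} }
                  ; ∙-cong = λ {x} {x′} {y} {y′} → +-cong {x} {x′} {y} {y′} }
                ; assoc = λ x y z → termwise {x + y + z} {x + (y + z)}
                    (λ n → ℚₚ.+-assoc (seq x n) (seq y n) (seq z n)) }
              ; identity = (λ x → termwise {0ℝ + x} {x} (λ n → ℚₚ.+-identityˡ (seq x n)))
                         , (λ x → termwise {x + 0ℝ} {x} (λ n → ℚₚ.+-identityʳ (seq x n))) }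
            ; inverse = (λ x → termwise { - x + x} {0ℝ} (λ n → ℚₚ.+-inverseˡ (seq x n)))
                      , (λ x → termwise {x + (- x)} {0ℝ} (λ n → ℚₚ.+-inverseʳ (seq x n)))
            ; ⁻¹-cong = λ {x} {y} → -‿cong {x} {y} }
          ; comm = λ x y → termwise {x + y} {y + x} (λ n → ℚₚ.+-comm (seq x n) (seq y n)) }
        ; *-cong = λ {x} {x′} {y} {y′} → *-cong {x} {x′} {y} {y′}
        ; *-assoc = λ x y z → termwise {x * y * z} {x * (y * z)}
            (λ n → ℚₚ.*-assoc (seq x n) (seq y n) (seq z n))
        ; *-identity = (λ x → termwise {1ℝ * x} {x} (λ n → ℚₚ.*-identityˡ (seq x n)))
                     , (λ x → termwise {x * 1ℝ} {x} (λ n → ℚₚ.*-identityʳ (seq x n)))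
        ; distrib = (λ x y z → termwise {x * (y + z)} {x * y + x * z}
                      (λ n → ℚₚ.*-distribˡ-+ (seq x n) (seq y n) (seq z n)))
                  , (λ x y z → termwise {(y + z) * x} {y * x + z * x}
                      (λ n → ℚₚ.*-distribʳ-+ (seq x n) (seq y n) (seq z n)))
        }
      ; *-comm = *-comm } }

  <-irrefl : ∀ {x} → ¬ (x < x)
  <-irrefl {x} (ε , ε>0 , N , f) = ℚₚ.<-irrefl refl (ℚₚ.<-≤-trans ε>0
    (≤-by (0≤diff (f N ℕₚ.≤-refl)) (solve 2 (λ x ε → x :- (x :+ ε) := con 0ℚ :- ε) refl (seq x N) ε)))

  <-trans : ∀ {x y z} → x < y → y < z → x < z
  <-trans {x} {y} {z} (ε , ε>0 , p) (η , η>0 , q) = ε , ε>0 , ev-map₂ (λ n p q →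
      ≤-by (ℚₚ.+-mono-≤ (ℚₚ.+-mono-≤ (0≤diff p) (0≤diff q)) (ℚₚ.<⇒≤ η>0))
        (solve 5 (λ x y z ε η → (y :- (x :+ ε)) :+ (z :- (y :+ η)) :+ η := z :- (x :+ ε)) refl
          (seq x n) (seq y n) (seq z n) ε η))
    p q

  <-respʳ : ∀ {x y z} → y ≈ z → x < y → x < z
  <-respʳ {x} {y} {z} y≈z (ε , ε>0 , p) = ½ ℚ.* ε , scale-pos ½ ε>0 , ev-map₂ (λ n p q →
      ≤-by (ℚₚ.+-mono-≤ (0≤diff p) (ℚₚ.<⇒≤ (above (seq y n) (seq z n) q)))
        (solve 4 (λ x y z ε → (y :- (x :+ ε)) :+ (con ½ :* ε :- (y :- z)) := z :- (x :+ con ½ :* ε)) refl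
          (seq x n) (seq y n) (seq z n) ε))
    p (y≈z (½ ℚ.* ε) (scale-pos ½ ε>0))

  <-respˡ : ∀ {x y z} → x ≈ y → x < z → y < z
  <-respˡ {x} {y} {z} x≈y (ε , ε>0 , p) = ½ ℚ.* ε , scale-pos ½ ε>0 , ev-map₂ (λ n p q →
      ≤-by (ℚₚ.+-mono-≤ (0≤diff p) (ℚₚ.<⇒≤ (below (seq x n) (seq y n) q)))
        (solve 4 (λ x y z ε → (z :- (x :+ ε)) :+ (con ½ :* ε :- (y :- x)) := z :- (y :+ con ½ :* ε)) refl
          (seq x n) (seq y n) (seq z n) ε))
    p (x≈y (½ ℚ.* ε) (scale-pos ½ ε>0))

  -- At such an index m the rational `seq x m` can represent x, so a comparison of reals becomes a
  -- decidable comparison of rationals.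
  Settled : ℝ → ℚ → ℕ → Set
  Settled x ε m = Eventually (λ n → ℚ.∣ seq x n ℚ.- seq x m ∣ ℚ.< ε)

  stable : ∀ x {ε} → 0ℚ ℚ.< ε → Eventually (Settled x ε)
  stable x {ε} ε>0 = let N , f = cauchy x ε ε>0 in N , λ m p → N , λ n q → f n m q p

  -- Each sequence drifts by less than ⅛ε from its m-th term, so the gap ½ε shrinks to no less than
  -- ¼ε.
  gap-at⇒< : ∀ {x y ε m} → 0ℚ ℚ.< ε →
    Settled x (⅛ ℚ.* ε) m → Settled y (⅛ ℚ.* ε) m →
    seq x m ℚ.+ ½ ℚ.* ε ℚ.≤ seq y m → x < y
  gap-at⇒< {x} {y} {ε} {m} ε>0 f g h = ¼ ℚ.* ε , scale-pos ¼ ε>0 , ev-map₂ (λ n f g →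
      ≤-by (ℚₚ.+-mono-≤ (0≤diff h)
             (ℚₚ.<⇒≤ (ℚₚ.+-mono-< (above (seq x n) (seq x m) f) (below (seq y n) (seq y m) g))))
        (solve 5 (λ x x₀ y y₀ ε →
          (y₀ :- (x₀ :+ con ½ :* ε))
            :+ ((con ⅛ :* ε :- (x :- x₀)) :+ (con ⅛ :* ε :- (y₀ :- y))) := y :- (x :+ con ¼ :* ε))
          refl (seq x n) (seq x m) (seq y n) (seq y m) ε))
    f g

  -- At one settled index z is compared with the rational x + ½ε: either it lies at least ½ε above
  -- x, or at least ½ε below y.
  <-cotrans : ∀ {x y} → x < y → ∀ z → (x < z) ⊎ (z < y)
  <-cotrans {x} {y} (ε , ε>0 , p) z = split (eventually-witness (ev-map₂ (λ _ → _,_)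
    (ev-map₂ (λ _ → _,_) p (stable z ⅛ε>0)) (ev-map₂ (λ _ → _,_) (stable x ⅛ε>0) (stable y ⅛ε>0))))
    where
    ⅛ε>0 : 0ℚ ℚ.< ⅛ ℚ.* ε
    ⅛ε>0 = scale-pos ⅛ ε>0
    split : (∃[ m ] (seq x m ℚ.+ ε ℚ.≤ seq y m × Settled z (⅛ ℚ.* ε) m)
      × (Settled x (⅛ ℚ.* ε) m × Settled y (⅛ ℚ.* ε) m)) → (x < z) ⊎ (z < y)
    split (m , (gap , fz) , (fx , fy)) = Sum.map (gap-at⇒< {x} {z} ε>0 fx fz)
      (λ z≤ → gap-at⇒< {z} {y} ε>0 fz fy (≤-by (ℚₚ.+-mono-≤ (0≤diff gap) (0≤diff z≤))
        (solve 4 (λ x y z ε → (y :- (x :+ ε)) :+ ((x :+ con ½ :* ε) :- z) := y :- (z :+ con ½ :* ε))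
          refl (seq x m) (seq y m) (seq z m) ε)))
      (ℚₚ.≤-total (seq x m ℚ.+ ½ ℚ.* ε) (seq z m))

  -- At a settled index a difference of ½ε in either direction would give a strict inequality. The ε
  -- is spent as ½ε there, ⅛ε for each drift, and ¼ε to spare.
  ≤-antisym : ∀ {x y} → x ≤ y → y ≤ x → x ≈ y
  ≤-antisym {x} {y} x≤y y≤x ε ε>0 =
    split (eventually-witness (ev-map₂ (λ _ → _,_) (stable x ⅛ε>0) (stable y ⅛ε>0)))
    where
    ⅛ε>0 : 0ℚ ℚ.< ⅛ ℚ.* ε
    ⅛ε>0 = scale-pos ⅛ ε>0
    e : ∀ x x₀ y y₀ → (y₀ ℚ.+ ½ ℚ.* ε ℚ.- x₀)
      ℚ.+ ((⅛ ℚ.* ε ℚ.- (x ℚ.- x₀)) ℚ.+ (⅛ ℚ.* ε ℚ.- (y₀ ℚ.- y)) ℚ.+ ¼ ℚ.* ε) ≡ ε ℚ.- (x ℚ.- y)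
    e x x₀ y y₀ = solve 5 (λ x x₀ y y₀ ε → (y₀ :+ con ½ :* ε :- x₀)
      :+ ((con ⅛ :* ε :- (x :- x₀)) :+ (con ⅛ :* ε :- (y₀ :- y)) :+ con ¼ :* ε) := ε :- (x :- y))
      refl x x₀ y y₀ ε
    no-gap : ∀ {x y m} → x ≤ y → Settled x (⅛ ℚ.* ε) m → Settled y (⅛ ℚ.* ε) m →
      0ℚ ℚ.< seq y m ℚ.+ ½ ℚ.* ε ℚ.- seq x m
    no-gap {x} {y} x≤y fx fy = 0<diff (ℚₚ.≰⇒> λ h → x≤y (gap-at⇒< {y} {x} ε>0 fy fx h))
    split : (∃[ m ] Settled x (⅛ ℚ.* ε) m × Settled y (⅛ ℚ.* ε) m) →
      Eventually (λ n → ℚ.∣ seq x n ℚ.- seq y n ∣ ℚ.< ε)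
    split (m , fx , fy) = ev-map₂ (λ n f g → close (seq x n) (seq y n)
        (subst (0ℚ ℚ.<_) (e (seq x n) (seq x m) (seq y n) (seq y m))
          (ℚₚ.+-mono-< (no-gap {x} {y} x≤y fx fy) (ℚₚ.+-mono-< (ℚₚ.+-mono-<
            (above (seq x n) (seq x m) f) (below (seq y n) (seq y m) g)) (scale-pos ¼ ε>0))))
        (subst (0ℚ ℚ.<_) (e (seq y n) (seq y m) (seq x n) (seq x m))
          (ℚₚ.+-mono-< (no-gap {y} {x} y≤x fy fx) (ℚₚ.+-mono-< (ℚₚ.+-mono-<
            (above (seq y n) (seq y m) g) (below (seq x n) (seq x m) f)) (scale-pos ¼ ε>0)))))
      fx fy

  +-monoˡ-< : ∀ {x y} z → x < y → x + z < y + z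
  +-monoˡ-< {x} {y} z (ε , ε>0 , p) = ε , ε>0 , ev-map (λ n p → ≤-by (0≤diff p)
    (solve 4 (λ x y z ε → y :- (x :+ ε) := (y :+ z) :- ((x :+ z) :+ ε)) refl
      (seq x n) (seq y n) (seq z n) ε)) p

  -- If B eventually bounds |x|, the gap δ = η/B works: a term of y below δ would make the product
  -- smaller than Bδ = η.
  *-cancel-pos : ∀ {x y} → 0ℝ < x → 0ℝ < x * y → 0ℝ < y
  *-cancel-pos {x} {y} (ε , ε>0 , p) (η , η>0 , q) =
    let B , B>0 , b = bounded x
        δ , δ>0 , e = quotient B>0 η>0
    in δ , δ>0 , ev-map₂ (λ n (p , b) q → subst (ℚ._≤ seq y n) (sym (ℚₚ.+-identityˡ δ))
         (ℚₚ.≮⇒≥ λ y<δ → ℚₚ.<-irrefl refl (ℚₚ.<-≤-trans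
           (ℚₚ.<-≤-trans (ℚₚ.*-monoʳ-<-pos (seq x n) {{x-pos p}} y<δ)
             (ℚₚ.*-monoʳ-≤-nonNeg δ {{ℚ.nonNegative (ℚₚ.<⇒≤ δ>0)}} (ℚₚ.≤-trans (p≤∣p∣ (seq x n)) b)))
           (subst (ℚ._≤ seq x n ℚ.* seq y n) (trans (ℚₚ.+-identityˡ η) (sym e)) q))))
       (ev-map₂ (λ _ → _,_) p b) q
    where
    x-pos : ∀ {a} → 0ℚ ℚ.+ ε ℚ.≤ a → ℚ.Positive a
    x-pos h = ℚ.positive (ℚₚ.<-≤-trans ε>0 (subst (ℚ._≤ _) (ℚₚ.+-identityˡ ε) h))

  fromℚ-mono-< : ∀ {p q} → p ℚ.< q → fromℚ p < fromℚ q
  fromℚ-mono-< {p} {q} p<q = q ℚ.- p , 0<diff p<q , 0 , λ _ _ →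
    ℚₚ.≤-reflexive (solve 2 (λ p q → p :+ (q :- p) := q) refl p q)

  eventually-≤ : ∀ {x y} → Eventually (λ n → seq x n ℚ.≤ seq y n) → x ≤ y
  eventually-≤ {x} {y} h (ε , ε>0 , p) = let n , h , p = eventually-witness (ev-map₂ (λ _ → _,_) h p) in
    ℚₚ.<-irrefl refl (ℚₚ.<-≤-trans ε>0 (≤-by (ℚₚ.+-mono-≤ (0≤diff p) (0≤diff h))
      (solve 3 (λ x y ε → (x :- (y :+ ε)) :+ (y :- x) := con 0ℚ :- ε) refl (seq x n) (seq y n) ε)))

  -- The strict gap pins down the sign, since eventually |xₙ| cannot equal xₙ. Combined with
  -- cotransitivity, this replaces a case distinction on the sign of x.
  <∣∣⇒∣∣≈- : ∀ {x} → x < ∣ x ∣ → ∣ x ∣ ≈ - x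
  <∣∣⇒∣∣≈- {x} (ε , ε>0 , p) η η>0 = ev-map (λ n p → subst (ℚ._< η)
      (sym (trans (cong (λ t → ℚ.∣ t ℚ.- (ℚ.- seq x n) ∣) (lemma p))
        (cong ℚ.∣_∣ (ℚₚ.+-inverseʳ (ℚ.- seq x n))))) η>0)
    p
    where
    lemma : ∀ {a} → a ℚ.+ ε ℚ.≤ ℚ.∣ a ∣ → ℚ.∣ a ∣ ≡ ℚ.- a
    lemma {a} h with ℚₚ.∣p∣≡p∨∣p∣≡-p a
    ... | inj₂ e = e
    ... | inj₁ e = ⊥-elim (ℚₚ.<-irrefl refl (ℚₚ.<-≤-trans ε>0
      (≤-by (0≤diff (subst (a ℚ.+ ε ℚ.≤_) e h)) (solve 2 (λ a ε → a :- (a :+ ε) := con 0ℚ :- ε) refl a ε))))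

  <∣∣-cases : ∀ {x z} → z < ∣ x ∣ → (z < x) ⊎ (z < - x)
  <∣∣-cases {x} {z} h = Sum.map₂ (λ x< → <-respʳ {z} {∣ x ∣} { - x} (<∣∣⇒∣∣≈- {x} x<) h)
    (<-cotrans {z} {∣ x ∣} h x)

  ∣∣<-intro′ : ∀ {x z} → x < z → - x < z → ∣ x ∣ < z
  ∣∣<-intro′ {x} {z} h h′ = Sum.[ (λ x< → <-respˡ { - x} {∣ x ∣} {z}
    (≈-sym {∣ x ∣} { - x} (<∣∣⇒∣∣≈- {x} x<)) h′) , (λ <z → <z) ]′ (<-cotrans {x} {z} h ∣ x ∣)

ℝ-constants : CommutativeRing.rawRing ℚₚ.+-*-commutativeRing
  -Raw-AlmostCommutative⟶ fromCommutativeRing ℝ-commutativeRing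
ℝ-constants = record
  { ⟦_⟧ = fromℚ
  ; +-homo = λ p q → termwise {fromℚ (p ℚ.+ q)} {fromℚ p + fromℚ q} (λ _ → refl)
  ; *-homo = λ p q → termwise {fromℚ (p ℚ.* q)} {fromℚ p * fromℚ q} (λ _ → refl)
  ; -‿homo = λ p → termwise {fromℚ (ℚ.- p)} { - fromℚ p} (λ _ → refl)
  ; 0-homo = termwise {0ℝ} {0ℝ} (λ _ → refl)
  ; 1-homo = termwise {1ℝ} {1ℝ} (λ _ → refl) }

x≤∣x∣ : ∀ x → x ≤ ∣ x ∣
x≤∣x∣ x = eventually-≤ {x} {∣ x ∣} (0 , λ n _ → p≤∣p∣ (seq x n))

-x≤∣x∣ : ∀ x → - x ≤ ∣ x ∣
-x≤∣x∣ x = eventually-≤ { - x} {∣ x ∣} (0 , λ n _ → -p≤∣p∣ (seq x n))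

ℝ-orderedRing : OrderedRing
ℝ-orderedRing = record
  { commutativeRing = ℝ-commutativeRing
  ; constants = ℝ-constants
  ; _<_ = _<_
  ; ∣_∣ = ∣_∣
  ; <-irrefl = λ {x} → <-irrefl {x}
  ; <-trans = λ {x} {y} {z} → <-trans {x} {y} {z}
  ; <-respˡ = λ {x} {y} {z} → <-respˡ {x} {y} {z}
  ; <-respʳ = λ {x} {y} {z} → <-respʳ {x} {y} {z}
  ; <-cotrans = λ {x} {y} → <-cotrans {x} {y}
  ; ≤-antisym = λ {x} {y} → ≤-antisym {x} {y}
  ; +-monoˡ-< = λ {x} {y} → +-monoˡ-< {x} {y}
  ; *-pos = λ {x} {y} → *-pos {x} {y}
  ; *-cancel-pos = λ {x} {y} → *-cancel-pos {x} {y}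
  ; ⌜⌝-mono-< = λ {p} {q} → fromℚ-mono-< {p} {q}
  ; x≤∣x∣ = x≤∣x∣
  ; -x≤∣x∣ = -x≤∣x∣
  ; <∣∣ = λ {x} {z} → <∣∣-cases {x} {z}
  ; ∣∣< = λ {x} {z} → ∣∣<-intro′ {x} {z} }

-- The Hecke group H₄

module O = OrderedRingProperties ℝ-orderedRing
module P = O.Parity {√2} √2-pos √2*√2≈2
open O using (⟦_⟧)
open P using (Entries)

H : (a b c d : ℝ) → Set
H a b c d = H₄ (mat a b c d)

det≈1 : Mat₂ → Set
det≈1 (mat a b c d) = a * d - c * b ≈ 1ℝ

H₄⇒det≈1 : ∀ {A} → H₄ A → det≈1 A
H₄⇒det≈1 gen-T = O.det-T √2
H₄⇒det≈1 gen-S = O.det-S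
H₄⇒det≈1 unit = O.det-T 0ℝ
H₄⇒det≈1 (product {mat a b c d} {mat a′ b′ c′ d′} M N) =
  O.det-product {a} {b} {c} {d} {a′} {b′} {c′} {d′} (H₄⇒det≈1 M) (H₄⇒det≈1 N)
H₄⇒det≈1 (inv {mat a b c d} M) = O.det-adjugate {a} {d} {c} {b} (H₄⇒det≈1 M)
H₄⇒det≈1 (resp {mat a b c d} {mat a′ b′ c′ d′} (inj₁ (ea , eb , ec , ed)) M) =
  O.det-resp {a} {b} {c} {d} {a′} {b′} {c′} {d′} ea eb ec ed (H₄⇒det≈1 M)
H₄⇒det≈1 (resp {mat a b c d} {mat a′ b′ c′ d′} (inj₂ (ea , eb , ec , ed)) M) =
  O.det-resp { - a} { - b} { - c} { - d} {a′} {b′} {c′} {d′}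
    (O.negate-swap {a} {a′} ea) (O.negate-swap {b} {b′} eb)
    (O.negate-swap {c} {c′} ec) (O.negate-swap {d} {d′} ed)
    (O.det-negate {a} {d} {c} {b} (H₄⇒det≈1 M))

HasEntries : Mat₂ → Set
HasEntries (mat a b c d) = ∃[ σ ] Entries σ a b c d

H₄⇒entries : ∀ {A} → H₄ A → HasEntries A
H₄⇒entries gen-T = false , P.entries-T
H₄⇒entries gen-S = true , P.entries-S
H₄⇒entries unit = false , P.entries-1
H₄⇒entries (product {mat a b c d} {mat a′ b′ c′ d′} M N) =
  let σ , M∈ = H₄⇒entries M
      τ , N∈ = H₄⇒entries N
  in σ xor τ , P.entries-product {a} {b} {c} {d} {a′} {b′} {c′} {d′} σ τ M∈ N∈
H₄⇒entries (inv {mat a b c d} M) =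
  let σ , M∈ = H₄⇒entries M in σ , P.entries-adjugate {a} {b} {c} {d} σ M∈
H₄⇒entries (resp {mat a b c d} {mat a′ b′ c′ d′} (inj₁ (ea , eb , ec , ed)) M) =
  let σ , M∈ = H₄⇒entries M
  in σ , P.entries-resp {a} {b} {c} {d} {a′} {b′} {c′} {d′} σ ea eb ec ed M∈
H₄⇒entries (resp {mat a b c d} {mat a′ b′ c′ d′} (inj₂ (ea , eb , ec , ed)) M) =
  let σ , M∈ = H₄⇒entries M
  in σ , P.entries-resp { - a} { - b} { - c} { - d} {a′} {b′} {c′} {d′} σ
    (O.negate-swap {a} {a′} ea) (O.negate-swap {b} {b′} eb)
    (O.negate-swap {c} {c′} ec) (O.negate-swap {d} {d′} ed)
    (P.entries-negate {a} {b} {c} {d} σ M∈)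

≈-refl : ∀ x → x ≈ x
≈-refl x = CommutativeRing.refl ℝ-commutativeRing {x}

H-product : ∀ {a b c d a′ b′ c′ d′} → H a b c d → H a′ b′ c′ d′ →
  H (a * a′ + b * c′) (a * b′ + b * d′) (c * a′ + d * c′) (c * b′ + d * d′)
H-product {a} {b} {c} {d} {a′} {b′} {c′} {d′} = product {mat a b c d} {mat a′ b′ c′ d′}

H-inverse : ∀ {a b c d} → H a b c d → H d (- b) (- c) a
H-inverse {a} {b} {c} {d} = inv {mat a b c d}

H-resp : ∀ {a b c d a′ b′ c′ d′} → a ≈ a′ → b ≈ b′ → c ≈ c′ → d ≈ d′ →
  H a b c d → H a′ b′ c′ d′
H-resp {a} {b} {c} {d} {a′} {b′} {c′} {d′} ea eb ec ed =
  resp {mat a b c d} {mat a′ b′ c′ d′} (inj₁ (ea , eb , ec , ed))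

H-negate : ∀ {a b c d} → H (- a) (- b) (- c) (- d) → H a b c d
H-negate {a} {b} {c} {d} = resp {mat (- a) (- b) (- c) (- d)} {mat a b c d}
  (inj₂ (≈-refl (- a) , ≈-refl (- b) , ≈-refl (- c) , ≈-refl (- d)))

det-H : ∀ {a b c d} → H a b c d → a * d - c * b ≈ 1ℝ
det-H = H₄⇒det≈1

entries-H : ∀ {a b c d} → H a b c d → ∃[ σ ] Entries σ a b c d
entries-H = H₄⇒entries

module Hecke = P.HeckeGroup H gen-T gen-S unit
  (λ {a} {b} {c} {d} {a′} {b′} {c′} {d′} → H-product {a} {b} {c} {d} {a′} {b′} {c′} {d′})
  (λ {a} {b} {c} {d} → H-inverse {a} {b} {c} {d})
  (λ {a} {b} {c} {d} {a′} {b′} {c′} {d′} → H-resp {a} {b} {c} {d} {a′} {b′} {c′} {d′})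
  (λ {a} {b} {c} {d} → H-negate {a} {b} {c} {d})
  (λ {a} {b} {c} {d} → det-H {a} {b} {c} {d})
  (λ {a} {b} {c} {d} → entries-H {a} {b} {c} {d})

-- The denominator of ε suffices: (b + 1) · (a + 1)/(b + 1) = a + 1 ≥ 1.
archimedean : ∀ {ε} → 0ℚ ℚ.< ε → ∃[ n ] 1ℚ ℚ.≤ fromℤ (ℤ.+ suc n) ℚ.* ε
archimedean {ε@(ℚ.mkℚ (ℤ.+ zero) _ _)} ε>0 with () ← ℚ.positive ε>0
archimedean {ε@(ℚ.mkℚ ℤ.-[1+ _ ] _ _)} ε>0 with () ← ℚ.positive ε>0
archimedean {ε@(ℚ.mkℚ (ℤ.+ suc a) b _)} _ = b , ℚₚ.toℚᵘ-cancel-≤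
  (ℚᵘₚ.≤-respʳ-≃ (ℚᵘₚ.≃-sym (ℚₚ.toℚᵘ-homo-* (fromℤ (ℤ.+ suc b)) ε))
    (ℚᵘ.*≤* (ℤ.+≤+ (subst₂ ℕ._≤_ (sym (trans (ℕₚ.+-identityʳ _) (ℕₚ.+-identityʳ _)))
      (sym (ℕₚ.*-identityʳ _)) (ℕₚ.m≤m*n (suc b) (suc a))))))

-- The three statements over the reals.

module _ (α : ℝ) (x : ℚH₄) where

  private
    p q u w : ℝ
    p = num x
    q = den x
    u = inverse q (den>0 x)
    w = inverse (q * q) (den²>0 x)

    module Value = O.Quotient {α} {p} {q} {u} {w} (den>0 x)
      (*-inverse q (den>0 x)) (*-inverse (q * q) (den²>0 x))

  best⇒close : x IsBestApproximationOf α → ∣ α - value x ∣ < 1ℝ / (den x * den x) ⟨ den²>0 x ⟩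
  best⇒close best =
    let r , s , M = col₂ x
        qξ<1 , q[-ξ]<1 = Hecke.best-is-close {α} {p} {q} (den>0 x)
          (λ {r} {r′} {s} {s′} → best′ {r} {r′} {s} {s′}) {r} {s} M
    in Value.∣α-p/q∣< {1ℝ} qξ<1 q[-ξ]<1
    where
    best′ : Hecke.BestApproximation α p q
    best′ {r} {r′} {s} {s′} N s>0 s≤q det≢0 = best
      (record { num = r ; den = s ; col₂ = r′ , s′ , N ; den>0 = s>0 })
      (λ e → det≢0 (O.det-of-equal-quotients {r} {inverse s s>0} {p} {u} {q} {s} e
        (*-inverse q (den>0 x)) (*-inverse s s>0)))
      s≤q

  close⇒best : ∣ α - value x ∣ < ½ℝ / (den x * den x) ⟨ den²>0 x ⟩ → x IsBestApproximationOf α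
  close⇒best close y y≉x s≤q =
    let r₀ , s₀ , M = col₂ x
        r′ , s′ , N = col₂ y
    in Hecke.close-best {α} {p} {q} {r₀} {s₀} (den>0 x) M (Value.q∣qα-p∣< {½ℝ} close)
      {num y} {r′} {den y} {s′} N (den>0 y) s≤q
      (λ det≈0 → y≉x (O.equal-quotients {p} {den y} {q} {num y} {u} {inverse (den y) (den>0 y)}
        det≈0 (*-inverse q (den>0 x)) (*-inverse (den y) (den>0 y))))

module _ {d k : ℝ} (M : H d k k d) (d>0 : 0ℝ < d) (k>0 : 0ℝ < k) where

  private
    module Pell = O.Pell {d} {k} d>0 k>0 (H₄⇒det≈1 M)

  k/d d/k : ℚH₄
  k/d = record { num = k ; den = d ; col₂ = - d , - k , Hecke.·S {d} {k} {k} {d} M ; den>0 = d>0 }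
  d/k = record { num = d ; den = k ; col₂ = k , d , M ; den>0 = k>0 }

  k/d-not-best : ¬ (k/d IsBestApproximationOf 1ℝ)
  k/d-not-best best = Pell.equidistant (best d/k
    (λ e → Pell.det≢0 (O.det-of-equal-quotients {d} {inverse k k>0} {k} {inverse d d>0} {d} {k} e
      (*-inverse d d>0) (*-inverse k k>0)))
    (O.<⇒≤ {k} {d} (O.0<diff⇒< {d} {k} Pell.gap-pos)))

  ∣1-k/d∣< : ∀ c → d * (d - k) < c → ∣ 1ℝ - value k/d ∣ < c / (d * d) ⟨ den²>0 k/d ⟩
  ∣1-k/d∣< c h = let h₁ , h₂ = Pell.gap<⇒ {c} h in
    O.Quotient.∣α-p/q∣< {1ℝ} {k} {d} {inverse d d>0} {inverse (d * d) (den²>0 k/d)} d>0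
      (*-inverse d d>0) (*-inverse (d * d) (den²>0 k/d)) {c} h₁ h₂

half-optimal : ∀ (c : ℝ) → ½ℝ < c → ∃[ α ] ∃[ x ]
  ∣ α - value x ∣ < c / (den x * den x) ⟨ den²>0 x ⟩ × ¬ (x IsBestApproximationOf α)
-- The proof of ½ < c carries a rational ε with ½ + ε ≤ c, and this ε fixes how far along the Pell
-- pairs to go.
half-optimal c (ε , ε>0 , ½+ε≤c) =
  let n , 1≤nε = archimedean ε>0
      d , k , M , d>0 , k>0 , gap = Hecke.close-pair (suc n) {fromℚ ε} (fromℚ-mono-< {0ℚ} {ε} ε>0)
        (eventually-≤ {1ℝ} {⟦ ℤ.+ suc n ⟧ * fromℚ ε} (0 , λ _ _ → 1≤nε)) (Hecke.1≤⟦suc⟧ n)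
  in 1ℝ , k/d {d} {k} M d>0 k>0
    , ∣1-k/d∣< {d} {k} M d>0 k>0 c (O.<-≤-trans {d * (d - k)} {½ℝ + fromℚ ε} {c} gap
        (eventually-≤ {½ℝ + fromℚ ε} {c} ½+ε≤c))
    , k/d-not-best {d} {k} M d>0 k>0

theorem1p3 : (∀ (α : ℝ) (x : ℚH₄) →
    (x IsBestApproximationOf α →
    ∣ α - value x ∣ < 1ℝ / (den x * den x) ⟨ den²>0 x ⟩)
    ×
    (∣ α - value x ∣ < ½ℝ / (den x * den x) ⟨ den²>0 x ⟩ →
    x IsBestApproximationOf α))
    ×
    (∀ (c : ℝ) → ½ℝ < c →
    ∃[ α ] ∃[ x ]
    ∣ α - value x ∣ < c / (den x * den x) ⟨ den²>0 x ⟩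
    × ¬ (x IsBestApproximationOf α))
theorem1p3 = (λ α x → best⇒close α x , close⇒best α x) , half-optimal
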